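{- Let $\phi$ be the real root of $x^3=x^2+x+1$. For any positive integers $n,k$ with $k\ge 4$, the number of positive tribonacci sequences of length $k$ terminating at $n$ is at most \[\left\lceil 1500\frac{n}{\phi^{3k/2}}\right\rceil^2.\]
   Context: A tribonacci sequence of length $k$ is a sequence of integers $\langle a_i\rangle_{i=1}^k$ such that $a_i=a_{i-1}+a_{i-2}+a_{i-3}$ for all $4\le i\le k$. It terminates at $a_k$, and it is positive if $a_1,a_2,a_3>0$. -}

module Defs where

open import Data.Nat as ℕ using (ℕ; zero; suc)
import Data.Nat.Properties as ℕ
open import Data.Integer as ℤ using (ℤ; +_)
open import Data.Rational as ℚ using (ℚ; 0ℚ; 1ℚ; ½; ∣_∣)
import Data.Rational.Properties as ℚ
open import Data.Rational.Solver using (module +-*-Solver)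
open import Data.Fin using (Fin; toℕ)
open import Data.Vec using (Vec; lookup)
open import Data.List using (List; length)
open import Data.List.Membership.Propositional using (_∈_)
open import Data.List.Relation.Unary.Unique.Propositional using (Unique)
open import Data.Product using (∃-syntax; _×_; _,_)
open import Function.Bundles using (_⇔_)
open import Relation.Binary.PropositionalEquality
  using (_≡_; refl; sym; trans; cong; cong₂; subst; subst₂)

------------------------------------------------------------------------
-- Real numbers: Cauchy sequences of rationals, up to _≃_

IsCauchy : (ℕ → ℚ) → Set
IsCauchy u = ∀ ε → 0ℚ ℚ.< ε →
  ∃[ N ] (∀ m n → N ℕ.≤ m → N ℕ.≤ n → ∣ u m ℚ.- u n ∣ ℚ.< ε)

record ℝ : Set where
  constructor mkℝ
  field
    seq    : ℕ → ℚ
    cauchy : IsCauchy seq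

open ℝ public

infix 4 _≃_ _<_ _≤_

_≃_ : ℝ → ℝ → Set
x ≃ y = ∀ ε → 0ℚ ℚ.< ε →
  ∃[ N ] (∀ n → N ℕ.≤ n → ∣ seq x n ℚ.- seq y n ∣ ℚ.< ε)

_<_ : ℝ → ℝ → Set
x < y = ∃[ ε ] (0ℚ ℚ.< ε ×
  ∃[ N ] (∀ n → N ℕ.≤ n → seq x n ℚ.+ ε ℚ.≤ seq y n))

_≤_ : ℝ → ℝ → Set
x ≤ y = ∀ ε → 0ℚ ℚ.< ε →
  ∃[ N ] (∀ n → N ℕ.≤ n → seq x n ℚ.≤ seq y n ℚ.+ ε)

private
  half-pos : ∀ {ε} → 0ℚ ℚ.< ε → 0ℚ ℚ.< ε ℚ.* ½
  half-pos {ε} ε>0 = subst (ℚ._< ε ℚ.* ½) (ℚ.*-zeroˡ ½) (ℚ.*-monoˡ-<-pos ½ ε>0)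

  *-pos : ∀ {p q} → 0ℚ ℚ.< p → 0ℚ ℚ.< q → 0ℚ ℚ.< p ℚ.* q
  *-pos {p} {q} p>0 q>0 = subst (ℚ._< p ℚ.* q) (ℚ.*-zeroˡ q)
    (ℚ.*-monoˡ-<-pos q {{ℚ.positive q>0}} p>0)

  halves : ∀ ε → ε ℚ.* ½ ℚ.+ ε ℚ.* ½ ≡ ε
  halves ε = trans (sym (ℚ.*-distribˡ-+ ε ½ ½)) (ℚ.*-identityʳ ε)

  1>0 : 0ℚ ℚ.< 1ℚ
  1>0 = ℚ.positive⁻¹ 1ℚ

  const-cauchy : ∀ q → IsCauchy (λ _ → q)
  const-cauchy q ε ε>0 = 0 , λ _ _ _ _ →
    subst (ℚ._< ε) (sym (cong ∣_∣ (ℚ.+-inverseʳ q))) ε>0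

  +-cauchy : ∀ u v → IsCauchy u → IsCauchy v → IsCauchy (λ n → u n ℚ.+ v n)
  +-cauchy u v cu cv ε ε>0 with cu (ε ℚ.* ½) (half-pos ε>0) | cv (ε ℚ.* ½) (half-pos ε>0)
  ... | N , hu | M , hv = N ℕ.⊔ M , λ m n Nm Nn → let open ℚ.≤-Reasoning in begin-strict
      ∣ (u m ℚ.+ v m) ℚ.- (u n ℚ.+ v n) ∣      ≡⟨ cong ∣_∣ (regroup (u m) (v m) (u n) (v n)) ⟩
      ∣ (u m ℚ.- u n) ℚ.+ (v m ℚ.- v n) ∣      ≤⟨ ℚ.∣p+q∣≤∣p∣+∣q∣ (u m ℚ.- u n) (v m ℚ.- v n) ⟩
      ∣ u m ℚ.- u n ∣ ℚ.+ ∣ v m ℚ.- v n ∣      <⟨ ℚ.+-mono-<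
        (hu m n (ℕ.m⊔n≤o⇒m≤o N M Nm) (ℕ.m⊔n≤o⇒m≤o N M Nn))
        (hv m n (ℕ.m⊔n≤o⇒n≤o N M Nm) (ℕ.m⊔n≤o⇒n≤o N M Nn)) ⟩
      ε ℚ.* ½ ℚ.+ ε ℚ.* ½                      ≡⟨ halves ε ⟩
      ε                                        ∎
    where
    regroup : ∀ a b c d → (a ℚ.+ b) ℚ.- (c ℚ.+ d) ≡ (a ℚ.- c) ℚ.+ (b ℚ.- d)
    regroup = solve 4 (λ a b c d → (a :+ b) :- (c :+ d) := (a :- c) :+ (b :- d)) refl
      where open +-*-Solver

  eventually-bounded : ∀ u → IsCauchy u →
    ∃[ B ] (0ℚ ℚ.< B × ∃[ N ] (∀ n → N ℕ.≤ n → ∣ u n ∣ ℚ.≤ B))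
  eventually-bounded u cu with cu 1ℚ 1>0
  ... | N , h = 1ℚ ℚ.+ ∣ u N ∣ , ℚ.+-mono-<-≤ 1>0 (ℚ.0≤∣p∣ (u N)) , N ,
    λ n Nn → let open ℚ.≤-Reasoning in begin
      ∣ u n ∣                       ≡⟨ cong ∣_∣ (split (u n) (u N)) ⟩
      ∣ (u n ℚ.- u N) ℚ.+ u N ∣     ≤⟨ ℚ.∣p+q∣≤∣p∣+∣q∣ (u n ℚ.- u N) (u N) ⟩
      ∣ u n ℚ.- u N ∣ ℚ.+ ∣ u N ∣   ≤⟨ ℚ.+-monoˡ-≤ ∣ u N ∣ (ℚ.<⇒≤ (h n N Nn ℕ.≤-refl)) ⟩
      1ℚ ℚ.+ ∣ u N ∣                ∎
    where
    split : ∀ a b → a ≡ (a ℚ.- b) ℚ.+ b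
    split = solve 2 (λ a b → a := (a :- b) :+ b) refl
      where open +-*-Solver

  shrink : ∀ {D ε} → 0ℚ ℚ.< D → 0ℚ ℚ.< ε → ∃[ δ ] (0ℚ ℚ.< δ × D ℚ.* δ ≡ ε)
  shrink {D} {ε} D>0 ε>0 = D⁻¹ ℚ.* ε , *-pos D⁻¹>0 ε>0 ,
    trans (sym (ℚ.*-assoc D D⁻¹ ε)) (trans (cong (ℚ._* ε) (ℚ.*-inverseʳ D {{nz}})) (ℚ.*-identityˡ ε))
    where
    nz : ℚ.NonZero D
    nz = ℚ.>-nonZero D>0
    D⁻¹ : ℚ
    D⁻¹ = (ℚ.1/ D) {{nz}}
    D⁻¹>0 : 0ℚ ℚ.< D⁻¹
    D⁻¹>0 = ℚ.positive⁻¹ D⁻¹ {{ℚ.1/pos⇒pos D {{ℚ.positive D>0}}}}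

  ∣*∣-bound : ∀ a b {K δ} → 0ℚ ℚ.< K → ∣ a ∣ ℚ.≤ K → ∣ b ∣ ℚ.< δ → ∣ a ℚ.* b ∣ ℚ.< K ℚ.* δ
  ∣*∣-bound a b {K} {δ} K>0 aK bδ = let open ℚ.≤-Reasoning in begin-strict
    ∣ a ℚ.* b ∣       ≡⟨ ℚ.∣p*q∣≡∣p∣*∣q∣ a b ⟩
    ∣ a ∣ ℚ.* ∣ b ∣   ≤⟨ ℚ.*-monoʳ-≤-nonNeg ∣ b ∣ {{ℚ.∣-∣-nonNeg b}} aK ⟩
    K ℚ.* ∣ b ∣       <⟨ ℚ.*-monoʳ-<-pos K {{ℚ.positive K>0}} bδ ⟩
    K ℚ.* δ           ∎

  *-diff : ∀ a b c d {B C δ} → 0ℚ ℚ.< B → 0ℚ ℚ.< C → ∣ a ∣ ℚ.≤ B → ∣ d ∣ ℚ.≤ C →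
    ∣ a ℚ.- c ∣ ℚ.< δ → ∣ b ℚ.- d ∣ ℚ.< δ → ∣ a ℚ.* b ℚ.- c ℚ.* d ∣ ℚ.< (B ℚ.+ C) ℚ.* δ
  *-diff a b c d {B} {C} {δ} B>0 C>0 aB dC ac bd = let open ℚ.≤-Reasoning in begin-strict
    ∣ a ℚ.* b ℚ.- c ℚ.* d ∣                           ≡⟨ cong ∣_∣ (regroup a b c d) ⟩
    ∣ a ℚ.* (b ℚ.- d) ℚ.+ d ℚ.* (a ℚ.- c) ∣           ≤⟨ ℚ.∣p+q∣≤∣p∣+∣q∣ (a ℚ.* (b ℚ.- d)) (d ℚ.* (a ℚ.- c)) ⟩
    ∣ a ℚ.* (b ℚ.- d) ∣ ℚ.+ ∣ d ℚ.* (a ℚ.- c) ∣       <⟨ ℚ.+-mono-<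
      (∣*∣-bound a (b ℚ.- d) B>0 aB bd) (∣*∣-bound d (a ℚ.- c) C>0 dC ac) ⟩
    B ℚ.* δ ℚ.+ C ℚ.* δ                               ≡⟨ sym (ℚ.*-distribʳ-+ δ B C) ⟩
    (B ℚ.+ C) ℚ.* δ                                   ∎
    where
    regroup : ∀ a b c d → a ℚ.* b ℚ.- c ℚ.* d ≡ a ℚ.* (b ℚ.- d) ℚ.+ d ℚ.* (a ℚ.- c)
    regroup = solve 4 (λ a b c d → a :* b :- c :* d := a :* (b :- d) :+ d :* (a :- c)) refl
      where open +-*-Solver

  *-cauchy : ∀ u v → IsCauchy u → IsCauchy v → IsCauchy (λ n → u n ℚ.* v n)
  *-cauchy u v cu cv ε ε>0 =
    let B , B>0 , N₁ , hB = eventually-bounded u cu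
        C , C>0 , N₂ , hC = eventually-bounded v cv
        δ , δ>0 , Dδ≡ε    = shrink (ℚ.+-mono-< B>0 C>0) ε>0
        N₃ , hu           = cu δ δ>0
        N₄ , hv           = cv δ δ>0
    in (N₁ ℕ.⊔ N₂) ℕ.⊔ (N₃ ℕ.⊔ N₄) , λ m n Nm Nn →
      let m₁₂ = ℕ.m⊔n≤o⇒m≤o (N₁ ℕ.⊔ N₂) (N₃ ℕ.⊔ N₄) Nm
          n₁₂ = ℕ.m⊔n≤o⇒m≤o (N₁ ℕ.⊔ N₂) (N₃ ℕ.⊔ N₄) Nn
          m₃₄ = ℕ.m⊔n≤o⇒n≤o (N₁ ℕ.⊔ N₂) (N₃ ℕ.⊔ N₄) Nm
          n₃₄ = ℕ.m⊔n≤o⇒n≤o (N₁ ℕ.⊔ N₂) (N₃ ℕ.⊔ N₄) Nn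
      in subst (∣ u m ℚ.* v m ℚ.- u n ℚ.* v n ∣ ℚ.<_) Dδ≡ε
        (*-diff (u m) (v m) (u n) (v n) B>0 C>0
          (hB m (ℕ.m⊔n≤o⇒m≤o N₁ N₂ m₁₂)) (hC n (ℕ.m⊔n≤o⇒n≤o N₁ N₂ n₁₂))
          (hu m n (ℕ.m⊔n≤o⇒m≤o N₃ N₄ m₃₄) (ℕ.m⊔n≤o⇒m≤o N₃ N₄ n₃₄))
          (hv m n (ℕ.m⊔n≤o⇒n≤o N₃ N₄ m₃₄) (ℕ.m⊔n≤o⇒n≤o N₃ N₄ n₃₄)))

fromℤ : ℤ → ℝ
fromℤ i = mkℝ (λ _ → i ℚ./ 1) (const-cauchy (i ℚ./ 1))

fromℕ : ℕ → ℝ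
fromℕ n = fromℤ (+ n)

infixl 6 _+_
infixl 7 _*_
infixr 8 _^_

_+_ : ℝ → ℝ → ℝ
x + y = mkℝ (λ n → seq x n ℚ.+ seq y n) (+-cauchy (seq x) (seq y) (cauchy x) (cauchy y))

_*_ : ℝ → ℝ → ℝ
x * y = mkℝ (λ n → seq x n ℚ.* seq y n) (*-cauchy (seq x) (seq y) (cauchy x) (cauchy y))

_^_ : ℝ → ℕ → ℝ
x ^ zero  = fromℕ 1
x ^ suc n = x * x ^ n

private
  ⊔-nonZero : ∀ p {ε} → 0ℚ ℚ.< ε → ℚ.NonZero (p ℚ.⊔ ε)
  ⊔-nonZero p {ε} ε>0 = ℚ.>-nonZero (ℚ.<-≤-trans ε>0 (ℚ.p≤q⊔p p ε))

-- The witness ε of 0 < x bounds the terms of x below only eventually; taking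
-- the maximum with ε keeps the remaining terms invertible and does not affect
-- the limit.
inv-seq : ∀ x → fromℕ 0 < x → ℕ → ℚ
inv-seq x (ε , ε>0 , _) n = (ℚ.1/ (seq x n ℚ.⊔ ε)) {{⊔-nonZero (seq x n) ε>0}}

private
  inv-diff : ∀ {a b ε δ} .{{_ : ℚ.NonZero a}} .{{_ : ℚ.NonZero b}} →
    0ℚ ℚ.< ε → ε ℚ.≤ a → ε ℚ.≤ b → ∣ a ℚ.- b ∣ ℚ.< (ε ℚ.* ε) ℚ.* δ →
    ∣ (ℚ.1/ a) ℚ.- (ℚ.1/ b) ∣ ℚ.< δ
  inv-diff {a} {b} {ε} {δ} ε>0 εa εb h =
    ℚ.*-cancelˡ-<-nonNeg (ε ℚ.* ε) (let open ℚ.≤-Reasoning in begin-strict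
      (ε ℚ.* ε) ℚ.* ∣ d ∣           ≤⟨ ℚ.*-monoʳ-≤-nonNeg ∣ d ∣ {{ℚ.∣-∣-nonNeg d}} εε≤ab ⟩
      (a ℚ.* b) ℚ.* ∣ d ∣           ≡⟨ cong (ℚ._* ∣ d ∣) (sym (ℚ.0≤p⇒∣p∣≡p (ℚ.<⇒≤ (*-pos a>0 b>0)))) ⟩
      ∣ a ℚ.* b ∣ ℚ.* ∣ d ∣         ≡⟨ sym (ℚ.∣p*q∣≡∣p∣*∣q∣ (a ℚ.* b) d) ⟩
      ∣ (a ℚ.* b) ℚ.* d ∣           ≡⟨ cong ∣_∣ expand ⟩
      ∣ ℚ.- (a ℚ.- b) ∣             ≡⟨ ℚ.∣-p∣≡∣p∣ (a ℚ.- b) ⟩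
      ∣ a ℚ.- b ∣                   <⟨ h ⟩
      (ε ℚ.* ε) ℚ.* δ               ∎)
    where
    d : ℚ
    d = (ℚ.1/ a) ℚ.- (ℚ.1/ b)
    a>0 : 0ℚ ℚ.< a
    a>0 = ℚ.<-≤-trans ε>0 εa
    b>0 : 0ℚ ℚ.< b
    b>0 = ℚ.<-≤-trans ε>0 εb
    instance
      ε-nn : ℚ.NonNegative ε
      ε-nn = ℚ.nonNegative (ℚ.<⇒≤ ε>0)
      b-nn : ℚ.NonNegative b
      b-nn = ℚ.nonNegative (ℚ.<⇒≤ b>0)
      εε-nn : ℚ.NonNegative (ε ℚ.* ε)
      εε-nn = ℚ.nonNegative (ℚ.<⇒≤ (*-pos ε>0 ε>0))
    εε≤ab : ε ℚ.* ε ℚ.≤ a ℚ.* b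
    εε≤ab = ℚ.≤-trans (ℚ.*-monoˡ-≤-nonNeg ε εb) (ℚ.*-monoʳ-≤-nonNeg b εa)
    regroup : ∀ a b i j → (a ℚ.* b) ℚ.* (i ℚ.- j) ≡ (a ℚ.* i) ℚ.* b ℚ.- a ℚ.* (b ℚ.* j)
    regroup = solve 4 (λ a b i j → (a :* b) :* (i :- j) := (a :* i) :* b :- a :* (b :* j)) refl
      where open +-*-Solver
    flip : ∀ a b → 1ℚ ℚ.* b ℚ.- a ℚ.* 1ℚ ≡ ℚ.- (a ℚ.- b)
    flip = solve 2 (λ a b → con 1ℚ :* b :- a :* con 1ℚ := :- (a :- b)) refl
      where open +-*-Solver
    expand : (a ℚ.* b) ℚ.* d ≡ ℚ.- (a ℚ.- b)
    expand = trans (regroup a b (ℚ.1/ a) (ℚ.1/ b))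
      (trans (cong₂ (λ p q → p ℚ.* b ℚ.- a ℚ.* q) (ℚ.*-inverseʳ a) (ℚ.*-inverseʳ b)) (flip a b))

  inv-cauchy : ∀ x (x>0 : fromℕ 0 < x) → IsCauchy (inv-seq x x>0)
  inv-cauchy x (ε , ε>0 , N , h) δ δ>0
    with cauchy x ((ε ℚ.* ε) ℚ.* δ) (*-pos (*-pos ε>0 ε>0) δ>0)
  ... | M , hx = N ℕ.⊔ M , λ m n Nm Nn →
    inv-diff {{⊔-nonZero (seq x m) ε>0}} {{⊔-nonZero (seq x n) ε>0}} ε>0
      (ℚ.p≤q⊔p (seq x m) ε) (ℚ.p≤q⊔p (seq x n) ε)
      (subst₂ (λ p q → ∣ p ℚ.- q ∣ ℚ.< (ε ℚ.* ε) ℚ.* δ)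
        (sym (big m (ℕ.m⊔n≤o⇒m≤o N M Nm))) (sym (big n (ℕ.m⊔n≤o⇒m≤o N M Nn)))
        (hx m n (ℕ.m⊔n≤o⇒n≤o N M Nm) (ℕ.m⊔n≤o⇒n≤o N M Nn)))
    where
    big : ∀ i → N ℕ.≤ i → seq x i ℚ.⊔ ε ≡ seq x i
    big i Ni = ℚ.p≥q⇒p⊔q≡p (subst (ℚ._≤ seq x i) (ℚ.+-identityˡ ε) (h i Ni))

infixl 7 _÷_[_]

_÷_[_] : ℝ → (y : ℝ) → fromℕ 0 < y → ℝ
x ÷ y [ y>0 ] = x * mkℝ (inv-seq y y>0) (inv-cauchy y y>0)

-- N = ⌈ x ⌉
IsCeiling : ℝ → ℤ → Set
IsCeiling x N = x ≤ fromℤ N × (∀ M → x ≤ fromℤ M → N ℤ.≤ M)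

------------------------------------------------------------------------
-- Tribonacci sequences ⟨a₁, …, aₖ⟩; aᵢ is the entry at the position i : Fin k
-- with suc (toℕ i) equal to the index

IsTribonacci : ∀ {k} → Vec ℤ k → Set
IsTribonacci {k} a = ∀ (h i j l : Fin k) →
  toℕ i ≡ 1 ℕ.+ toℕ h → toℕ j ≡ 2 ℕ.+ toℕ h → toℕ l ≡ 3 ℕ.+ toℕ h →
  lookup a l ≡ lookup a j ℤ.+ lookup a i ℤ.+ lookup a h

IsPositive : ∀ {k} → Vec ℤ k → Set
IsPositive {k} a = ∀ (i : Fin k) → toℕ i ℕ.< 3 → + 0 ℤ.< lookup a i

TerminatesAt : ∀ {k} → ℤ → Vec ℤ k → Set
TerminatesAt {k} n a = ∀ (i : Fin k) → suc (toℕ i) ≡ k → lookup a i ≡ n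

PositiveTribonacci : (k n : ℕ) → Vec ℤ k → Set
PositiveTribonacci k n a = IsTribonacci a × IsPositive a × TerminatesAt (+ n) a

-- { x ∣ P x } is finite with exactly c elements
HasCardinality : {A : Set} → (A → Set) → ℕ → Set
HasCardinality {A} P c =
  ∃[ xs ] (Unique xs × (∀ (x : A) → x ∈ xs ⇔ P x) × length xs ≡ c)

{-# OPTIONS --safe #-}

-- Two solutions with the same final term differ by a tribonacci sequence
-- (d₁, d₂, d₃, …) whose k-th term is 0.  Read backwards from that term it is an
-- integral combination u g + v g⁺ of the backward sequence g = 0, 0, 1, −1, 0, 2, …
-- and its shift, and the 2 × 2 minors of g and g⁺ are the tribonacci numbers t.
-- Since g grows only like φ^{k/2} while t grows like φ^k, Cramer's rule forces
-- max(|d₁|, |d₂|) to be at least of order φ^{k/2} unless d = 0.  As a₁ and a₂ are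
-- at most of order n/φ^k, cutting their range into N × N cells with N of order
-- n/φ^{3k/2} leaves at most one solution per cell.
--
-- The growth of g is controlled by quadratic forms in three consecutive terms:
-- g_{j+1}² − g_j g_{j+2} is exactly t_{j+1}, and adding the square of an almost
-- contracted linear functional ℓ makes it dominate g_j².

module Submission where

open import Defs
open import Data.Nat as ℕ using (ℕ; zero; suc; _/_; _%_)
open import Data.Integer as ℤ using (ℤ; +_; 0ℤ; 1ℤ)
open import Data.Product using (∃-syntax; _×_; _,_; proj₁; proj₂)
import Data.Nat.Properties as ℕ
import Data.Nat.DivMod as ℕ
import Data.Nat.Tactic.RingSolver as ℕRing
import Data.Integer.Properties as ℤ
import Data.Integer.Tactic.RingSolver as ℤRing
open import Data.Rational as ℚ using (ℚ; 0ℚ; 1ℚ; ½; ∣_∣)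
import Data.Rational.Properties as ℚ
import Data.Rational.Unnormalised as ℚᵘ
import Data.Rational.Unnormalised.Properties as ℚᵘ
open import Data.Rational.Solver using (module +-*-Solver)
open import Data.Empty using (⊥-elim)
open import Data.Fin as Fin using (Fin; toℕ)
import Data.Fin.Properties as Fin
open import Data.List as List using (List; length; filter; map; upTo; cartesianProduct)
import Data.List.Properties as List
import Data.List.Relation.Unary.All as All
open import Data.List.Relation.Unary.AllPairs using (_∷_)
open import Data.List.Membership.Propositional using (_∈_)
open import Data.List.Membership.Propositional.Properties
open import Data.List.Relation.Unary.Unique.Propositional using (Unique)
import Data.List.Relation.Unary.Unique.Propositional.Properties as Unique
open import Data.Sum using (_⊎_; inj₁; inj₂)
open import Data.Vec using (Vec; lookup; tabulate)
open import Data.Vec.Properties using (lookup∘tabulate; tabulate∘lookup; tabulate-cong)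
open import Function.Bundles using (mk⇔)
open import Relation.Nullary using (¬_; Dec; yes; no)
open import Relation.Binary.PropositionalEquality

-- Tribonacci numbers and the backward sequence

t : ℕ → ℕ
t 0 = 0
t 1 = 0
t 2 = 1
t (suc (suc (suc n))) = t (suc (suc n)) ℕ.+ t (suc n) ℕ.+ t n

t≥1 : ∀ n → 1 ℕ.≤ t (2 ℕ.+ n)
t≥1 zero    = ℕ.≤-refl
t≥1 (suc n) = ℕ.≤-trans (t≥1 n)
  (ℕ.≤-trans (ℕ.m≤m+n _ (t (1 ℕ.+ n))) (ℕ.m≤m+n _ (t n)))

-- By the recurrence one step down, `c + b + a ≤ c + (b + a + t n) = 2 c`. The factor 2 stands in
-- for φ when neighbouring indices are compared.
t-double : ∀ n → t (3 ℕ.+ n) ℕ.≤ 2 ℕ.* t (2 ℕ.+ n)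
t-double zero    = ℕ.s≤s ℕ.z≤n
t-double (suc n) = let open ℕ.≤-Reasoning in begin
  c ℕ.+ b ℕ.+ a          ≤⟨ ℕ.m≤m+n _ (t n) ⟩
  c ℕ.+ b ℕ.+ a ℕ.+ t n  ≡⟨ lem b a (t n) ⟩
  2 ℕ.* c                ∎
  where
  a = t (1 ℕ.+ n)
  b = t (2 ℕ.+ n)
  c = t (3 ℕ.+ n)
  lem : ∀ b a d → b ℕ.+ a ℕ.+ d ℕ.+ b ℕ.+ a ℕ.+ d ≡ 2 ℕ.* (b ℕ.+ a ℕ.+ d)
  lem = ℕRing.solve-∀

t-mono : ∀ n → t (1 ℕ.+ n) ℕ.≤ t (2 ℕ.+ n)
t-mono zero    = ℕ.z≤n
t-mono (suc n) = ℕ.≤-trans (ℕ.m≤m+n _ (t (1 ℕ.+ n))) (ℕ.m≤m+n _ (t n))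

trib : ℤ → ℤ → ℤ → ℕ → ℤ
trib a b c zero    = a
trib a b c (suc i) = trib b c (c ℤ.+ b ℤ.+ a) i

-- As `trib` recurses on its initial values, the induction hypothesis is taken at the shifted
-- triple. The coefficients are nonnegative, which later bounds positive initial values by the last
-- term.
trib-closed : ∀ a b c m → trib a b c (2 ℕ.+ m) ≡
  + t (1 ℕ.+ m) ℤ.* a ℤ.+ (+ t (1 ℕ.+ m) ℤ.+ + t m) ℤ.* b ℤ.+ + t (2 ℕ.+ m) ℤ.* c
trib-closed a b c zero    = lem a b c
  where
  lem : ∀ a b c → c ≡ + 0 ℤ.* a ℤ.+ (+ 0 ℤ.+ + 0) ℤ.* b ℤ.+ + 1 ℤ.* c
  lem = ℤRing.solve-∀
trib-closed a b c (suc m) = trans (trib-closed b c (c ℤ.+ b ℤ.+ a) m)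
  (lem a b c (+ t m) (+ t (1 ℕ.+ m)) (+ t (2 ℕ.+ m)))
  where
  lem : ∀ a b c x y z → y ℤ.* b ℤ.+ (y ℤ.+ x) ℤ.* c ℤ.+ z ℤ.* (c ℤ.+ b ℤ.+ a) ≡
    z ℤ.* a ℤ.+ (z ℤ.+ y) ℤ.* b ℤ.+ (z ℤ.+ y ℤ.+ x) ℤ.* c
  lem = ℤRing.solve-∀

g : ℕ → ℤ
g 0 = + 0
g 1 = + 0
g 2 = + 1
g (suc (suc (suc n))) = g n ℤ.- g (suc n) ℤ.- g (suc (suc n))

-- The products of pairs of the roots 1/φ, 1/α, 1/ᾱ governing g are the roots
-- φ, α, ᾱ of the original recurrence, because φ α ᾱ = 1.
g-det : ∀ n → g (1 ℕ.+ n) ℤ.* g (1 ℕ.+ n) ℤ.- g n ℤ.* g (2 ℕ.+ n) ≡ + t (1 ℕ.+ n)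
g-det 0 = refl
g-det 1 = refl
g-det 2 = refl
g-det (suc (suc (suc n))) = trans (lem (g n) (g (1 ℕ.+ n)) (g (2 ℕ.+ n)))
  (cong₂ ℤ._+_ (cong₂ ℤ._+_ (g-det (suc (suc n))) (g-det (suc n))) (g-det n))
  where
  lem : ∀ a b c →
    let d = a ℤ.- b ℤ.- c
        e = b ℤ.- c ℤ.- d
        f = c ℤ.- d ℤ.- e
    in e ℤ.* e ℤ.- d ℤ.* f ≡
       (d ℤ.* d ℤ.- c ℤ.* e) ℤ.+ (c ℤ.* c ℤ.- b ℤ.* d) ℤ.+ (b ℤ.* b ℤ.- a ℤ.* c)
  lem = ℤRing.solve-∀

0≤x² : ∀ x → 0ℤ ℤ.≤ x ℤ.* x
0≤x² (+ zero)     = ℤ.+≤+ ℕ.z≤n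
0≤x² (+ suc n)    = ℤ.+≤+ ℕ.z≤n
0≤x² ℤ.-[1+ n ] = ℤ.+≤+ ℕ.z≤n

≤-by-diff : ∀ {x y} d → y ≡ x ℤ.+ d → 0ℤ ℤ.≤ d → x ℤ.≤ y
≤-by-diff {x} d refl 0≤d =
  subst (ℤ._≤ x ℤ.+ d) (ℤ.+-identityʳ x) (ℤ.+-monoʳ-≤ x 0≤d)

-- An integral approximation to the linear functional that the backward
-- recurrence contracts, namely 1 : 0.84 : 0.54.
ℓ : ℕ → ℤ
ℓ n = + 2 ℤ.* g n ℤ.+ g (1 ℕ.+ n) ℤ.+ g (2 ℕ.+ n)

-- With `a`, `b`, `c` the terms of `g` from index `n` on, adding twice the minor `b² − a c` to
-- `ℓ n ² − ℓ (1 + n)²` gives the sum of squares `(a + b + c)² + 2 a² + b²`.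
ℓ-step : ∀ n → ℓ (1 ℕ.+ n) ℤ.* ℓ (1 ℕ.+ n) ℤ.≤ ℓ n ℤ.* ℓ n ℤ.+ + 2 ℤ.* + t (1 ℕ.+ n)
ℓ-step n = subst (λ r → ℓ (1 ℕ.+ n) ℤ.* ℓ (1 ℕ.+ n) ℤ.≤ ℓ n ℤ.* ℓ n ℤ.+ + 2 ℤ.* r) (g-det n)
  (≤-by-diff _ (lem (g n) (g (1 ℕ.+ n)) (g (2 ℕ.+ n)))
    (ℤ.+-mono-≤ (ℤ.+-mono-≤ (ℤ.+-mono-≤
      (0≤x² (g n ℤ.+ g (1 ℕ.+ n) ℤ.+ g (2 ℕ.+ n))) (0≤x² (g n))) (0≤x² (g n))) (0≤x² (g (1 ℕ.+ n)))))
  where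
  lem : ∀ a b c →
    let m = + 2 ℤ.* a ℤ.+ b ℤ.+ c
        m′ = + 2 ℤ.* b ℤ.+ c ℤ.+ (a ℤ.- b ℤ.- c)
        s = a ℤ.+ b ℤ.+ c
    in m ℤ.* m ℤ.+ + 2 ℤ.* (b ℤ.* b ℤ.- a ℤ.* c) ≡
       m′ ℤ.* m′ ℤ.+ (s ℤ.* s ℤ.+ a ℤ.* a ℤ.+ a ℤ.* a ℤ.+ b ℤ.* b)
  lem = ℤRing.solve-∀

-- The increments from `ℓ-step` fit into the recurrence of `t`, leaving `2 t n` to spare at each
-- step.
ℓ²-bound : ∀ n → ℓ n ℤ.* ℓ n ℤ.≤ + (2 ℕ.* t (2 ℕ.+ n))
ℓ²-bound zero    = ℤ.+≤+ (ℕ.s≤s ℕ.z≤n)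
ℓ²-bound (suc n) = let open ℤ.≤-Reasoning in begin
  ℓ (1 ℕ.+ n) ℤ.* ℓ (1 ℕ.+ n)                    ≤⟨ ℓ-step n ⟩
  ℓ n ℤ.* ℓ n ℤ.+ + 2 ℤ.* + t (1 ℕ.+ n)          ≤⟨ ℤ.+-monoˡ-≤ (+ 2 ℤ.* + t (1 ℕ.+ n)) (ℓ²-bound n) ⟩
  + (2 ℕ.* t (2 ℕ.+ n)) ℤ.+ + 2 ℤ.* + t (1 ℕ.+ n)  ≡⟨ cong (λ r → + (2 ℕ.* t (2 ℕ.+ n)) ℤ.+ r) (sym (ℤ.pos-* 2 (t (1 ℕ.+ n)))) ⟩
  + (2 ℕ.* t (2 ℕ.+ n) ℕ.+ 2 ℕ.* t (1 ℕ.+ n))    ≤⟨ ℤ.+≤+ (ℕ.m≤m+n _ (2 ℕ.* t n)) ⟩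
  + (2 ℕ.* t (2 ℕ.+ n) ℕ.+ 2 ℕ.* t (1 ℕ.+ n) ℕ.+ 2 ℕ.* t n)
    ≡⟨ cong +_ (lem (t (2 ℕ.+ n)) (t (1 ℕ.+ n)) (t n)) ⟩
  + (2 ℕ.* t (3 ℕ.+ n))                          ∎
  where
  lem : ∀ x y z → 2 ℕ.* x ℕ.+ 2 ℕ.* y ℕ.+ 2 ℕ.* z ≡ 2 ℕ.* (x ℕ.+ y ℕ.+ z)
  lem = ℕRing.solve-∀

-- The form `ℓ² + b² − a c − a²` is positive semidefinite; the factor 4 clears the denominators of
-- its decomposition into squares.
g²≤ℓ²+t : ∀ n → g n ℤ.* g n ℤ.≤ ℓ n ℤ.* ℓ n ℤ.+ + t (1 ℕ.+ n)
g²≤ℓ²+t n = subst (λ r → g n ℤ.* g n ℤ.≤ ℓ n ℤ.* ℓ n ℤ.+ r) (g-det n)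
  (ℤ.*-cancelʳ-≤-pos (g n ℤ.* g n) _ (+ 4) (≤-by-diff _ (lem (g n) (g (1 ℕ.+ n)) (g (2 ℕ.+ n)))
    (ℤ.+-mono-≤ (ℤ.+-mono-≤ (ℤ.+-mono-≤
      (0≤x² (+ 3 ℤ.* g n ℤ.+ + 2 ℤ.* g (1 ℕ.+ n) ℤ.+ + 2 ℤ.* g (2 ℕ.+ n)))
      (0≤x² (g n ℤ.+ + 2 ℤ.* g (1 ℕ.+ n)))) (0≤x² (g n))) (0≤x² (g n)))))
  where
  lem : ∀ a b c →
    let m = + 2 ℤ.* a ℤ.+ b ℤ.+ c
        s = + 3 ℤ.* a ℤ.+ + 2 ℤ.* b ℤ.+ + 2 ℤ.* c
        r = a ℤ.+ + 2 ℤ.* b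
    in (m ℤ.* m ℤ.+ (b ℤ.* b ℤ.- a ℤ.* c)) ℤ.* + 4 ≡
       a ℤ.* a ℤ.* + 4 ℤ.+ (s ℤ.* s ℤ.+ r ℤ.* r ℤ.+ a ℤ.* a ℤ.+ a ℤ.* a)
  lem = ℤRing.solve-∀

∣x∣²≡x² : ∀ x → + (ℤ.∣ x ∣ ℕ.* ℤ.∣ x ∣) ≡ x ℤ.* x
∣x∣²≡x² (+ n)        = ℤ.pos-* n n
∣x∣²≡x² ℤ.-[1+ n ] = refl

∣g∣²-bound : ∀ n → ℤ.∣ g n ∣ ℕ.* ℤ.∣ g n ∣ ℕ.≤ 2 ℕ.* t (2 ℕ.+ n) ℕ.+ t (1 ℕ.+ n)
∣g∣²-bound n = ℤ.drop‿+≤+ (subst (ℤ._≤ + (2 ℕ.* t (2 ℕ.+ n) ℕ.+ t (1 ℕ.+ n))) (sym (∣x∣²≡x² (g n)))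
  (ℤ.≤-trans (g²≤ℓ²+t n) (ℤ.+-monoˡ-≤ (+ t (1 ℕ.+ n)) (ℓ²-bound n))))

-- The coefficients `u` and `v` are fixed at the vanishing term and carried backward unchanged,
-- because `a` is recovered from the three following terms by the recurrence that defines `g`.
trib-zero : ∀ m a b c → trib a b c (2 ℕ.+ m) ≡ 0ℤ → ∃[ u ] ∃[ v ]
  (a ≡ u ℤ.* g (3 ℕ.+ m) ℤ.+ v ℤ.* g (2 ℕ.+ m)
  × b ≡ u ℤ.* g (2 ℕ.+ m) ℤ.+ v ℤ.* g (1 ℕ.+ m)
  × c ≡ u ℤ.* g (1 ℕ.+ m) ℤ.+ v ℤ.* g m)
-- Here `g 3`, `g 2`, `g 1`, `g 0` are -1, 1, 0, 0, so the equations read `a = v − u` and `b = u`.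
trib-zero zero a b c refl = b , a ℤ.+ b , eq₁ a b , eq₂ a b , eq₃ a b
  where
  eq₁ : ∀ a b → a ≡ b ℤ.* ℤ.-1ℤ ℤ.+ (a ℤ.+ b) ℤ.* 1ℤ
  eq₁ = ℤRing.solve-∀
  eq₂ : ∀ a b → b ≡ b ℤ.* 1ℤ ℤ.+ (a ℤ.+ b) ℤ.* 0ℤ
  eq₂ = ℤRing.solve-∀
  eq₃ : ∀ a b → 0ℤ ≡ b ℤ.* 0ℤ ℤ.+ (a ℤ.+ b) ℤ.* 0ℤ
  eq₃ = ℤRing.solve-∀
trib-zero (suc m) a b c eq with trib-zero m b c (c ℤ.+ b ℤ.+ a) eq
... | u , v , refl , refl , e = u , v ,
  trans (back a _ _ e) (lem u v (g m) (g (1 ℕ.+ m)) (g (2 ℕ.+ m))) , refl , refl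
  where
  back : ∀ {s} a b c → c ℤ.+ b ℤ.+ a ≡ s → a ≡ s ℤ.- c ℤ.- b
  back a b c refl = cancel a b c
    where
    cancel : ∀ a b c → a ≡ c ℤ.+ b ℤ.+ a ℤ.- c ℤ.- b
    cancel = ℤRing.solve-∀
  lem : ∀ u v w x y →
    let z = w ℤ.- x ℤ.- y in
    (u ℤ.* x ℤ.+ v ℤ.* w) ℤ.- (u ℤ.* y ℤ.+ v ℤ.* x) ℤ.- (u ℤ.* z ℤ.+ v ℤ.* y) ≡
    u ℤ.* (x ℤ.- y ℤ.- z) ℤ.+ v ℤ.* z
  lem = ℤRing.solve-∀

-- Sparsity of the solution lattice

sq-mono : ∀ {a b} → a ℕ.≤ b → a ℕ.* a ℕ.≤ b ℕ.* b
sq-mono a≤b = ℕ.*-mono-≤ a≤b a≤b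

abs-sum² : ∀ {a b s} → a ℕ.* a ℕ.+ b ℕ.* b ℕ.≤ s →
  (a ℕ.+ b) ℕ.* (a ℕ.+ b) ℕ.≤ 2 ℕ.* s
abs-sum² {a} {b} {s} h = ℕ.≤-trans (am-gm a b) (ℕ.*-monoʳ-≤ 2 h)
  where
  ordered : ∀ a d → (a ℕ.+ (a ℕ.+ d)) ℕ.* (a ℕ.+ (a ℕ.+ d)) ℕ.≤ 2 ℕ.* (a ℕ.* a ℕ.+ (a ℕ.+ d) ℕ.* (a ℕ.+ d))
  ordered a d = subst ((a ℕ.+ (a ℕ.+ d)) ℕ.* (a ℕ.+ (a ℕ.+ d)) ℕ.≤_) (lem a d) (ℕ.m≤m+n _ (d ℕ.* d))
    where
    lem : ∀ a d → (a ℕ.+ (a ℕ.+ d)) ℕ.* (a ℕ.+ (a ℕ.+ d)) ℕ.+ d ℕ.* d ≡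
      2 ℕ.* (a ℕ.* a ℕ.+ (a ℕ.+ d) ℕ.* (a ℕ.+ d))
    lem = ℕRing.solve-∀
  am-gm : ∀ a b → (a ℕ.+ b) ℕ.* (a ℕ.+ b) ℕ.≤ 2 ℕ.* (a ℕ.* a ℕ.+ b ℕ.* b)
  am-gm a b with ℕ.≤-total a b
  ... | inj₁ a≤b = subst (λ b → (a ℕ.+ b) ℕ.* (a ℕ.+ b) ℕ.≤ 2 ℕ.* (a ℕ.* a ℕ.+ b ℕ.* b))
    (ℕ.m+[n∸m]≡n a≤b) (ordered a (b ℕ.∸ a))
  ... | inj₂ b≤a = subst₂ (λ x y → x ℕ.* x ℕ.≤ 2 ℕ.* y) (ℕ.+-comm b a) (ℕ.+-comm (b ℕ.* b) (a ℕ.* a))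
    (subst (λ a → (b ℕ.+ a) ℕ.* (b ℕ.+ a) ℕ.≤ 2 ℕ.* (b ℕ.* b ℕ.+ a ℕ.* a))
      (ℕ.m+[n∸m]≡n b≤a) (ordered b (a ℕ.∸ b)))

-- 2304 = 36 · 2² · 4².
size-contradiction : ∀ {K L X z T Q N n} → 2304 ℕ.* L ℕ.< K ℕ.* K →
  1 ℕ.≤ X → 1 ℕ.≤ z → 1 ℕ.≤ N → z ℕ.≤ 2 ℕ.* X → T ℕ.≤ 2 ℕ.* z →
  (K ℕ.* n) ℕ.* (K ℕ.* n) ℕ.≤ N ℕ.* N ℕ.* (L ℕ.* (T ℕ.* T ℕ.* T)) →
  Q ℕ.* Q ℕ.≤ 36 ℕ.* T → ¬ z ℕ.* (X ℕ.* N) ℕ.≤ n ℕ.* Q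
size-contradiction {K} {L} {X} {z} {T} {Q} {N} {n} L<K² X≥1 z≥1 N≥1 z≤2X T≤2z hn hQ h =
  ℕ.<⇒≱ L<K² (ℕ.*-cancelʳ-≤ (K ℕ.* K) (2304 ℕ.* L) (W ℕ.* W) {{ℕ.>-nonZero W²≥1}} chain)
  where
  W = z ℕ.* (X ℕ.* N)
  W≥1 : 1 ℕ.≤ W
  W≥1 = ℕ.*-mono-≤ z≥1 (ℕ.*-mono-≤ X≥1 N≥1)
  W²≥1 : 1 ℕ.≤ W ℕ.* W
  W²≥1 = ℕ.*-mono-≤ W≥1 W≥1
  T≤4X : T ℕ.≤ 4 ℕ.* X
  T≤4X = subst (T ℕ.≤_) (sym (ℕ.*-assoc 2 2 X)) (ℕ.≤-trans T≤2z (ℕ.*-monoʳ-≤ 2 z≤2X))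
  e₁ : ∀ K n Q → K ℕ.* K ℕ.* ((n ℕ.* Q) ℕ.* (n ℕ.* Q)) ≡ (K ℕ.* n) ℕ.* (K ℕ.* n) ℕ.* (Q ℕ.* Q)
  e₁ = ℕRing.solve-∀
  e₂ : ∀ a L N T → N ℕ.* N ℕ.* (L ℕ.* (T ℕ.* T ℕ.* T)) ℕ.* (a ℕ.* T) ≡
    a ℕ.* L ℕ.* (N ℕ.* N) ℕ.* ((T ℕ.* T) ℕ.* (T ℕ.* T))
  e₂ = ℕRing.solve-∀
  e₃ : ∀ a b c L N X z →
    a ℕ.* L ℕ.* (N ℕ.* N) ℕ.* (((b ℕ.* z) ℕ.* (b ℕ.* z)) ℕ.* ((c ℕ.* X) ℕ.* (c ℕ.* X))) ≡
    a ℕ.* b ℕ.* b ℕ.* c ℕ.* c ℕ.* L ℕ.* ((z ℕ.* (X ℕ.* N)) ℕ.* (z ℕ.* (X ℕ.* N)))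
  e₃ = ℕRing.solve-∀
  -- Squaring avoids roots: the bounds for `n²` and `Q²` multiply to a multiple of `N² T⁴`, which
  -- `T ≤ 2 z` and `T ≤ 4 X` turn into a multiple of `W²`.
  chain : K ℕ.* K ℕ.* (W ℕ.* W) ℕ.≤ 2304 ℕ.* L ℕ.* (W ℕ.* W)
  chain = let open ℕ.≤-Reasoning in begin
    K ℕ.* K ℕ.* (W ℕ.* W)                              ≤⟨ ℕ.*-monoʳ-≤ (K ℕ.* K) (sq-mono h) ⟩
    K ℕ.* K ℕ.* ((n ℕ.* Q) ℕ.* (n ℕ.* Q))              ≡⟨ e₁ K n Q ⟩
    (K ℕ.* n) ℕ.* (K ℕ.* n) ℕ.* (Q ℕ.* Q)              ≤⟨ ℕ.*-mono-≤ hn hQ ⟩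
    N ℕ.* N ℕ.* (L ℕ.* (T ℕ.* T ℕ.* T)) ℕ.* (36 ℕ.* T)  ≡⟨ e₂ 36 L N T ⟩
    36 ℕ.* L ℕ.* (N ℕ.* N) ℕ.* ((T ℕ.* T) ℕ.* (T ℕ.* T))
      ≤⟨ ℕ.*-monoʳ-≤ (36 ℕ.* L ℕ.* (N ℕ.* N)) (ℕ.*-mono-≤ (sq-mono T≤2z) (sq-mono T≤4X)) ⟩
    36 ℕ.* L ℕ.* (N ℕ.* N) ℕ.* (((2 ℕ.* z) ℕ.* (2 ℕ.* z)) ℕ.* ((4 ℕ.* X) ℕ.* (4 ℕ.* X)))
      ≡⟨ e₃ 36 2 4 L N X z ⟩
    2304 ℕ.* L ℕ.* (W ℕ.* W)                           ∎

-- Integrality enters here: a nonzero `w` has absolute value at least 1, so the numerator in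
-- Cramer's rule is at least `z` in absolute value, while the smallness of `d₁` and `d₂` bounds it
-- from above.
minor-bound : ∀ {M n} w z d₁ d₂ q₁ q₂ → w ℤ.* + z ≡ d₁ ℤ.* q₂ ℤ.- d₂ ℤ.* q₁ → w ≢ 0ℤ →
  ℤ.∣ d₁ ∣ ℕ.* M ℕ.≤ n → ℤ.∣ d₂ ∣ ℕ.* M ℕ.≤ n →
  z ℕ.* M ℕ.≤ n ℕ.* (ℤ.∣ q₁ ∣ ℕ.+ ℤ.∣ q₂ ∣)
minor-bound {M} {n} w z d₁ d₂ q₁ q₂ eq w≢0 h₁ h₂ = let open ℕ.≤-Reasoning in begin
  z ℕ.* M                                      ≤⟨ ℕ.*-monoˡ-≤ M z≤ ⟩
  (a₁ ℕ.* b₂ ℕ.+ a₂ ℕ.* b₁) ℕ.* M              ≡⟨ lem a₁ a₂ b₁ b₂ M ⟩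
  a₂ ℕ.* M ℕ.* b₁ ℕ.+ a₁ ℕ.* M ℕ.* b₂          ≤⟨ ℕ.+-mono-≤ (ℕ.*-monoˡ-≤ b₁ h₂) (ℕ.*-monoˡ-≤ b₂ h₁) ⟩
  n ℕ.* b₁ ℕ.+ n ℕ.* b₂                        ≡⟨ sym (ℕ.*-distribˡ-+ n b₁ b₂) ⟩
  n ℕ.* (b₁ ℕ.+ b₂)                            ∎
  where
  a₁ = ℤ.∣ d₁ ∣
  a₂ = ℤ.∣ d₂ ∣
  b₁ = ℤ.∣ q₁ ∣
  b₂ = ℤ.∣ q₂ ∣
  lem : ∀ a₁ a₂ b₁ b₂ M → (a₁ ℕ.* b₂ ℕ.+ a₂ ℕ.* b₁) ℕ.* M ≡ a₂ ℕ.* M ℕ.* b₁ ℕ.+ a₁ ℕ.* M ℕ.* b₂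
  lem = ℕRing.solve-∀
  ∣w∣≥1 : 1 ℕ.≤ ℤ.∣ w ∣
  ∣w∣≥1 = ℕ.n≢0⇒n>0 (λ e → w≢0 (ℤ.∣i∣≡0⇒i≡0 e))
  z≤ : z ℕ.≤ a₁ ℕ.* b₂ ℕ.+ a₂ ℕ.* b₁
  z≤ = let open ℕ.≤-Reasoning in begin
    z                                       ≤⟨ ℕ.m≤n*m z ℤ.∣ w ∣ {{ℕ.>-nonZero ∣w∣≥1}} ⟩
    ℤ.∣ w ∣ ℕ.* z                           ≡⟨ sym (ℤ.abs-* w (+ z)) ⟩
    ℤ.∣ w ℤ.* + z ∣                         ≡⟨ cong ℤ.∣_∣ eq ⟩
    ℤ.∣ d₁ ℤ.* q₂ ℤ.- d₂ ℤ.* q₁ ∣           ≤⟨ ℤ.∣i-j∣≤∣i∣+∣j∣ (d₁ ℤ.* q₂) (d₂ ℤ.* q₁) ⟩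
    ℤ.∣ d₁ ℤ.* q₂ ∣ ℕ.+ ℤ.∣ d₂ ℤ.* q₁ ∣     ≡⟨ cong₂ ℕ._+_ (ℤ.abs-* d₁ q₂) (ℤ.abs-* d₂ q₁) ⟩
    a₁ ℕ.* b₂ ℕ.+ a₂ ℕ.* b₁                 ∎

g-pair-bound : ∀ n → let Q = ℤ.∣ g n ∣ ℕ.+ ℤ.∣ g (1 ℕ.+ n) ∣ in
  Q ℕ.* Q ℕ.≤ 6 ℕ.* t (3 ℕ.+ n) ℕ.+ 6 ℕ.* t (2 ℕ.+ n)
g-pair-bound n = ℕ.≤-trans (abs-sum² {ℤ.∣ g n ∣} {ℤ.∣ g (1 ℕ.+ n) ∣} (ℕ.+-mono-≤ (∣g∣²-bound n) (∣g∣²-bound (1 ℕ.+ n))))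
  (let open ℕ.≤-Reasoning in begin
    2 ℕ.* (2 ℕ.* t (2 ℕ.+ n) ℕ.+ t (1 ℕ.+ n) ℕ.+ (2 ℕ.* t (3 ℕ.+ n) ℕ.+ t (2 ℕ.+ n)))
      ≤⟨ ℕ.m≤m+n _ (2 ℕ.* t n ℕ.+ 2 ℕ.* t (2 ℕ.+ n)) ⟩
    _ ≡⟨ lem (t n) (t (1 ℕ.+ n)) (t (2 ℕ.+ n)) ⟩
    6 ℕ.* t (3 ℕ.+ n) ℕ.+ 6 ℕ.* t (2 ℕ.+ n) ∎)
  where
  lem : ∀ a b c → let d = c ℕ.+ b ℕ.+ a in
    2 ℕ.* (2 ℕ.* c ℕ.+ b ℕ.+ (2 ℕ.* d ℕ.+ c)) ℕ.+ (2 ℕ.* a ℕ.+ 2 ℕ.* c) ≡ 6 ℕ.* d ℕ.+ 6 ℕ.* c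
  lem = ℕRing.solve-∀


-- Lowering all indices to `2 + n` by doubling gives the constant `(6 · 2 + 6) · 2 = 36`.
g-pair-bound′ : ∀ n → let Q = ℤ.∣ g (1 ℕ.+ n) ∣ ℕ.+ ℤ.∣ g (2 ℕ.+ n) ∣ in
  Q ℕ.* Q ℕ.≤ 36 ℕ.* t (2 ℕ.+ n)
g-pair-bound′ n = ℕ.≤-trans (g-pair-bound (1 ℕ.+ n)) (let open ℕ.≤-Reasoning in begin
  6 ℕ.* t (4 ℕ.+ n) ℕ.+ 6 ℕ.* t (3 ℕ.+ n)
    ≤⟨ ℕ.+-monoˡ-≤ (6 ℕ.* t (3 ℕ.+ n)) (ℕ.*-monoʳ-≤ 6 (t-double (1 ℕ.+ n))) ⟩
  6 ℕ.* (2 ℕ.* t (3 ℕ.+ n)) ℕ.+ 6 ℕ.* t (3 ℕ.+ n)   ≡⟨ e₁ (t (3 ℕ.+ n)) ⟩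
  18 ℕ.* t (3 ℕ.+ n)                                ≤⟨ ℕ.*-monoʳ-≤ 18 (t-double n) ⟩
  18 ℕ.* (2 ℕ.* t (2 ℕ.+ n))                        ≡⟨ e₂ (t (2 ℕ.+ n)) ⟩
  36 ℕ.* t (2 ℕ.+ n)                                ∎)
  where
  e₁ : ∀ x → 6 ℕ.* (2 ℕ.* x) ℕ.+ 6 ℕ.* x ≡ 18 ℕ.* x
  e₁ = ℕRing.solve-∀
  e₂ : ∀ x → 18 ℕ.* (2 ℕ.* x) ≡ 36 ℕ.* x
  e₂ = ℕRing.solve-∀

-- Applied to the difference of two solutions in one cell. Cramer's rule expresses `u` and `v`
-- through `a` and `b`; if either were nonzero, `minor-bound` would contradict `size-contradiction`.
-- Then `c` vanishes too, being a combination of the same `u` and `v`.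
lattice-sparse : ∀ {K L} j {N n} a b c → trib a b c (3 ℕ.+ j) ≡ 0ℤ → 2304 ℕ.* L ℕ.< K ℕ.* K → 1 ℕ.≤ N →
  ℤ.∣ a ∣ ℕ.* (t (2 ℕ.+ j) ℕ.* N) ℕ.≤ n → ℤ.∣ b ∣ ℕ.* (t (2 ℕ.+ j) ℕ.* N) ℕ.≤ n →
  (K ℕ.* n) ℕ.* (K ℕ.* n) ℕ.≤
    N ℕ.* N ℕ.* (L ℕ.* (t (4 ℕ.+ j) ℕ.* t (4 ℕ.+ j) ℕ.* t (4 ℕ.+ j))) →
  a ≡ 0ℤ × b ≡ 0ℤ × c ≡ 0ℤ
lattice-sparse {K} {L} j {N} {n} a b c end L<K² N≥1 ha hb hn
  with trib-zero (1 ℕ.+ j) a b c end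
... | u , v , a≡ , b≡ , c≡ = conclude (u ℤ.≟ 0ℤ) (v ℤ.≟ 0ℤ)
  where
  z = t (3 ℕ.+ j)
  p = g (2 ℕ.+ j)
  q = g (3 ℕ.+ j)
  r = g (4 ℕ.+ j)
  u-minor : ∀ u v p q r → ℤ.- u ℤ.* (q ℤ.* q ℤ.- p ℤ.* r) ≡
    (u ℤ.* r ℤ.+ v ℤ.* q) ℤ.* p ℤ.- (u ℤ.* q ℤ.+ v ℤ.* p) ℤ.* q
  u-minor = ℤRing.solve-∀
  v-minor : ∀ u v p q r → v ℤ.* (q ℤ.* q ℤ.- p ℤ.* r) ≡
    (u ℤ.* r ℤ.+ v ℤ.* q) ℤ.* q ℤ.- (u ℤ.* q ℤ.+ v ℤ.* p) ℤ.* r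
  v-minor = ℤRing.solve-∀
  minor : ∀ w x y → w ℤ.* (q ℤ.* q ℤ.- p ℤ.* r) ≡
    (u ℤ.* r ℤ.+ v ℤ.* q) ℤ.* x ℤ.- (u ℤ.* q ℤ.+ v ℤ.* p) ℤ.* y →
    w ≢ 0ℤ → z ℕ.* (t (2 ℕ.+ j) ℕ.* N) ℕ.≤ n ℕ.* (ℤ.∣ y ∣ ℕ.+ ℤ.∣ x ∣)
  minor w x y eq w≢0 = minor-bound w z a b y x
    (trans (cong (w ℤ.*_) (sym (g-det (2 ℕ.+ j))))
      (trans eq (cong₂ (λ a b → a ℤ.* x ℤ.- b ℤ.* y) (sym a≡) (sym b≡)))) w≢0 ha hb
  impossible : ∀ {Q} → Q ℕ.* Q ℕ.≤ 36 ℕ.* t (4 ℕ.+ j) → ¬ z ℕ.* (t (2 ℕ.+ j) ℕ.* N) ℕ.≤ n ℕ.* Q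
  impossible {Q} = size-contradiction {K} {L} {t (2 ℕ.+ j)} {z} {t (4 ℕ.+ j)} {Q} {N} {n}
    L<K² (t≥1 j) (t≥1 (1 ℕ.+ j)) N≥1 (t-double j) (t-double (1 ℕ.+ j)) hn
  conclude : Dec (u ≡ 0ℤ) → Dec (v ≡ 0ℤ) → a ≡ 0ℤ × b ≡ 0ℤ × c ≡ 0ℤ
  conclude (yes refl) (yes refl) = a≡ , b≡ , c≡
  -- The minor for `u` uses `p` and `q`, one index below the pair for `v`; `t-mono` lifts its bound
  -- to the same `t (4 + j)`.
  conclude (no u≢0) _ = ⊥-elim (impossible {ℤ.∣ q ∣ ℕ.+ ℤ.∣ p ∣}
    (subst (λ Q → Q ℕ.* Q ℕ.≤ 36 ℕ.* t (4 ℕ.+ j)) (ℕ.+-comm ℤ.∣ p ∣ ℤ.∣ q ∣)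
      (ℕ.≤-trans (g-pair-bound′ (1 ℕ.+ j)) (ℕ.*-monoʳ-≤ 36 (t-mono (2 ℕ.+ j)))))
    (minor (ℤ.- u) p q (u-minor u v p q r) (λ e → u≢0 (ℤ.neg-injective e))))
  conclude (yes _) (no v≢0) = ⊥-elim (impossible {ℤ.∣ r ∣ ℕ.+ ℤ.∣ q ∣}
    (subst (λ Q → Q ℕ.* Q ℕ.≤ 36 ℕ.* t (4 ℕ.+ j)) (ℕ.+-comm ℤ.∣ q ∣ ℤ.∣ r ∣) (g-pair-bound′ (2 ℕ.+ j)))
    (minor v q r (v-minor u v p q r) v≢0))

-- Counting the solutions

tribVec : ∀ k → ℤ → ℤ → ℤ → Vec ℤ k
tribVec k a b c = tabulate (λ i → trib a b c (toℕ i))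

trib-step : ∀ a b c i → trib a b c (3 ℕ.+ i) ≡ trib a b c (2 ℕ.+ i) ℤ.+ trib a b c (1 ℕ.+ i) ℤ.+ trib a b c i
trib-step a b c zero    = refl
trib-step a b c (suc i) = trib-step b c (c ℤ.+ b ℤ.+ a) i

trib-isTribonacci : ∀ k a b c → IsTribonacci (tribVec k a b c)
trib-isTribonacci k a b c h i j l i≡ j≡ l≡
  rewrite lookup∘tabulate (λ i → trib a b c (toℕ i)) h
        | lookup∘tabulate (λ i → trib a b c (toℕ i)) i
        | lookup∘tabulate (λ i → trib a b c (toℕ i)) j
        | lookup∘tabulate (λ i → trib a b c (toℕ i)) l
        | i≡ | j≡ | l≡ = trib-step a b c (toℕ h)

isTribonacci-unique : ∀ {k} (v w : Vec ℤ (3 ℕ.+ k)) → IsTribonacci v → IsTribonacci w →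
  (∀ i → toℕ i ℕ.< 3 → lookup v i ≡ lookup w i) → v ≡ w
isTribonacci-unique {k} v w hv hw init = begin
  v                    ≡⟨ sym (tabulate∘lookup v) ⟩
  tabulate (lookup v)  ≡⟨ tabulate-cong (λ i → proj₁ (window (toℕ i)) i refl) ⟩
  tabulate (lookup w)  ≡⟨ tabulate∘lookup w ⟩
  w                    ∎
  where
  open ≡-Reasoning
  -- Indexing by natural numbers lets the induction run past the end of the vectors, where agreement
  -- is vacuous.
  Agree : ℕ → Set
  Agree m = ∀ i → toℕ i ≡ m → lookup v i ≡ lookup w i
  at : ∀ m (i : Fin (3 ℕ.+ k)) d → toℕ i ≡ d ℕ.+ m → ∃[ h ] (toℕ {3 ℕ.+ k} h ≡ m)
  at m i d eq = Fin.fromℕ< m< , Fin.toℕ-fromℕ< m<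
    where
    m< : m ℕ.< 3 ℕ.+ k
    m< = ℕ.≤-<-trans (ℕ.m≤n+m m d) (subst (ℕ._< 3 ℕ.+ k) eq (Fin.toℕ<n i))
  window : ∀ m → Agree m × Agree (1 ℕ.+ m) × Agree (2 ℕ.+ m)
  window zero =
    (λ i e → init i (subst (ℕ._< 3) (sym e) (ℕ.s≤s ℕ.z≤n))) ,
    (λ i e → init i (subst (ℕ._< 3) (sym e) (ℕ.s≤s (ℕ.s≤s ℕ.z≤n)))) ,
    (λ i e → init i (subst (ℕ._< 3) (sym e) (ℕ.s≤s (ℕ.s≤s (ℕ.s≤s ℕ.z≤n)))))
  window (suc m) with window m
  ... | h₀ , h₁ , h₂ = h₁ , h₂ , λ l l≡ →
    let h , h≡ = at m l 3 l≡
        i , i≡ = at (1 ℕ.+ m) l 2 l≡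
        j , j≡ = at (2 ℕ.+ m) l 1 l≡
        i≡′ = trans i≡ (cong (1 ℕ.+_) (sym h≡))
        j≡′ = trans j≡ (cong (2 ℕ.+_) (sym h≡))
        l≡′ = trans l≡ (cong (3 ℕ.+_) (sym h≡))
    in begin
      lookup v l                                        ≡⟨ hv h i j l i≡′ j≡′ l≡′ ⟩
      lookup v j ℤ.+ lookup v i ℤ.+ lookup v h          ≡⟨ cong₂ ℤ._+_ (cong₂ ℤ._+_ (h₂ j j≡) (h₁ i i≡)) (h₀ h h≡) ⟩
      lookup w j ℤ.+ lookup w i ℤ.+ lookup w h          ≡⟨ sym (hw h i j l i≡′ j≡′ l≡′) ⟩
      lookup w l                                        ∎

trib-minus : ∀ a b c a′ b′ c′ m →
  trib a b c m ℤ.- trib a′ b′ c′ m ≡ trib (a ℤ.- a′) (b ℤ.- b′) (c ℤ.- c′) m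
trib-minus a b c a′ b′ c′ zero    = refl
trib-minus a b c a′ b′ c′ (suc m) =
  trans (trib-minus b c (c ℤ.+ b ℤ.+ a) b′ c′ (c′ ℤ.+ b′ ℤ.+ a′) m)
    (cong (λ s → trib (b ℤ.- b′) (c ℤ.- c′) s m) (lem a b c a′ b′ c′))
  where
  lem : ∀ a b c a′ b′ c′ → (c ℤ.+ b ℤ.+ a) ℤ.- (c′ ℤ.+ b′ ℤ.+ a′) ≡
    (c ℤ.- c′) ℤ.+ (b ℤ.- b′) ℤ.+ (a ℤ.- a′)
  lem = ℤRing.solve-∀

lookup-injective : {A : Set} {xs : List A} → Unique xs → ∀ i j →
  List.lookup xs i ≡ List.lookup xs j → i ≡ j
lookup-injective (_ ∷ _)  Fin.zero    Fin.zero    _  = refl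
lookup-injective (x∉ ∷ _) Fin.zero    (Fin.suc j) eq = ⊥-elim (All.lookup x∉ (∈-lookup j) eq)
lookup-injective (x∉ ∷ _) (Fin.suc i) Fin.zero    eq = ⊥-elim (All.lookup x∉ (∈-lookup i) (sym eq))
lookup-injective (_ ∷ u)  (Fin.suc i) (Fin.suc j) eq = cong Fin.suc (lookup-injective u i j eq)

-- A pigeonhole principle. The map `f` receives the membership proof because the cell of a triple is
-- only defined through bounds that solutions satisfy.
unique-length≤ : {A : Set} {xs : List A} {m : ℕ} → Unique xs → (f : ∀ x → x ∈ xs → Fin m) →
  (∀ x y (x∈ : x ∈ xs) (y∈ : y ∈ xs) → f x x∈ ≡ f y y∈ → x ≡ y) → length xs ℕ.≤ m
unique-length≤ {xs = xs} u f f-inj =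
  Fin.injective⇒≤ {f = λ i → f (List.lookup xs i) (∈-lookup i)}
    (λ {i} {j} eq → lookup-injective u i j (f-inj _ _ (∈-lookup i) (∈-lookup j) eq))

-- Numbers with equal quotients differ only in their remainders, which are below `n`.
quotient-close : ∀ a b M n .{{_ : ℕ.NonZero n}} →
  (a ℕ.* M) / n ≡ (b ℕ.* M) / n → ℤ.∣ + a ℤ.- + b ∣ ℕ.* M ℕ.≤ n
quotient-close a b M n eq =
  subst (λ d → ℤ.∣ d ∣ ℕ.* M ℕ.≤ n) (sym (ℤ.m-n≡m⊖n a b)) (close (ℕ.≤-total a b))
  where
  ordered : ∀ a b → (a ℕ.* M) / n ≡ (b ℕ.* M) / n → (b ℕ.∸ a) ℕ.* M ℕ.≤ n
  ordered a b eq = subst (ℕ._≤ n) (sym (ℕ.*-distribʳ-∸ M b a))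
    (ℕ.m≤n+o⇒m∸n≤o (b ℕ.* M) (a ℕ.* M) (let open ℕ.≤-Reasoning in begin
      b ℕ.* M                                        ≡⟨ ℕ.m≡m%n+[m/n]*n (b ℕ.* M) n ⟩
      (b ℕ.* M) % n ℕ.+ (b ℕ.* M) / n ℕ.* n          ≤⟨ ℕ.+-monoˡ-≤ _ (ℕ.<⇒≤ (ℕ.m%n<n (b ℕ.* M) n)) ⟩
      n ℕ.+ (b ℕ.* M) / n ℕ.* n                      ≡⟨ cong (λ q → n ℕ.+ q ℕ.* n) (sym eq) ⟩
      n ℕ.+ (a ℕ.* M) / n ℕ.* n                      ≤⟨ ℕ.+-monoʳ-≤ n (ℕ.m/n*n≤m (a ℕ.* M) n) ⟩
      n ℕ.+ a ℕ.* M                                  ≡⟨ ℕ.+-comm n (a ℕ.* M) ⟩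
      a ℕ.* M ℕ.+ n                                  ∎))
  close : a ℕ.≤ b ⊎ b ℕ.≤ a → ℤ.∣ a ℤ.⊖ b ∣ ℕ.* M ℕ.≤ n
  close (inj₁ a≤b) = subst (λ d → d ℕ.* M ℕ.≤ n) (sym (ℤ.∣⊖∣-≤ a≤b)) (ordered a b eq)
  close (inj₂ b≤a) = subst (λ d → d ℕ.* M ℕ.≤ n)
    (sym (trans (ℤ.∣m⊖n∣≡∣n⊖m∣ a b) (ℤ.∣⊖∣-≤ b≤a))) (ordered b a (sym eq))

-- Enumeration of the solutions by initial values, and the cells

Triple : Set
Triple = ℕ × ℕ × ℕ

-- The triple (a , b , c) encodes the positive initial values a + 1, b + 1, c + 1.
entry : Triple → ℕ → ℤ
entry (a , b , c) = trib (+ suc a) (+ suc b) (+ suc c)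

toVec : ∀ k → Triple → Vec ℤ k
toVec k (a , b , c) = tribVec k (+ suc a) (+ suc b) (+ suc c)

-- The map `ℕ.pred ∣_∣` undoes the shift by 1 in each of the first three entries.
toVec-injective : ∀ k {x y} → toVec (3 ℕ.+ k) x ≡ toVec (3 ℕ.+ k) y → x ≡ y
toVec-injective k eq = cong₂ _,_ (at Fin.zero)
  (cong₂ _,_ (at (Fin.suc Fin.zero)) (at (Fin.suc (Fin.suc Fin.zero))))
  where
  at : ∀ i → ℕ.pred ℤ.∣ lookup (toVec (3 ℕ.+ k) _) i ∣ ≡ ℕ.pred ℤ.∣ lookup (toVec (3 ℕ.+ k) _) i ∣
  at i = cong (λ v → ℕ.pred ℤ.∣ lookup v i ∣) eq

entry-ℕ : ∀ a b c m n → entry (a , b , c) (2 ℕ.+ m) ≡ + n →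
  n ≡ t (1 ℕ.+ m) ℕ.* suc a ℕ.+ (t (1 ℕ.+ m) ℕ.+ t m) ℕ.* suc b ℕ.+ t (2 ℕ.+ m) ℕ.* suc c
entry-ℕ a b c m n eq = ℤ.+-injective (begin
  + n                       ≡⟨ sym eq ⟩
  entry (a , b , c) (2 ℕ.+ m)  ≡⟨ trib-closed (+ suc a) (+ suc b) (+ suc c) m ⟩
  + x ℤ.* + suc a ℤ.+ + y ℤ.* + suc b ℤ.+ + z ℤ.* + suc c
    ≡⟨ sym (cong₂ ℤ._+_ (cong₂ ℤ._+_ (ℤ.pos-* x (suc a)) (ℤ.pos-* y (suc b))) (ℤ.pos-* z (suc c))) ⟩
  + (x ℕ.* suc a ℕ.+ y ℕ.* suc b ℕ.+ z ℕ.* suc c)  ∎)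
  where
  open ≡-Reasoning
  x = t (1 ℕ.+ m)
  y = t (1 ℕ.+ m) ℕ.+ t m
  z = t (2 ℕ.+ m)

-- In the closed form `suc a` and `suc b` have coefficients at least `t (2 + j)`. The term in `c` is
-- at least 1, which makes two of the bounds strict, as needed for a cell index below `N`.
entry-bounds : ∀ a b c j n → entry (a , b , c) (3 ℕ.+ j) ≡ + n →
  suc a ℕ.* t (2 ℕ.+ j) ℕ.< n × suc b ℕ.* t (2 ℕ.+ j) ℕ.< n × suc c ℕ.≤ n
entry-bounds a b c j n eq = a-bound , b-bound , c-bound
  where
  x = t (2 ℕ.+ j)
  y = t (2 ℕ.+ j) ℕ.+ t (1 ℕ.+ j)
  z = t (3 ℕ.+ j)
  n≡ : n ≡ x ℕ.* suc a ℕ.+ y ℕ.* suc b ℕ.+ z ℕ.* suc c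
  n≡ = entry-ℕ a b c (1 ℕ.+ j) n eq
  zc≥1 : 1 ℕ.≤ z ℕ.* suc c
  zc≥1 = ℕ.*-mono-≤ (t≥1 (1 ℕ.+ j)) (ℕ.s≤s ℕ.z≤n)
  head< : x ℕ.* suc a ℕ.+ y ℕ.* suc b ℕ.< n
  head< = subst (x ℕ.* suc a ℕ.+ y ℕ.* suc b ℕ.<_) (sym n≡) (ℕ.m<m+n _ zc≥1)
  a-bound : suc a ℕ.* x ℕ.< n
  a-bound = subst (ℕ._< n) (ℕ.*-comm x (suc a)) (ℕ.≤-<-trans (ℕ.m≤m+n _ _) head<)
  b-bound : suc b ℕ.* x ℕ.< n
  b-bound = subst (ℕ._< n) (ℕ.*-comm x (suc b))
    (ℕ.≤-<-trans (ℕ.≤-trans (ℕ.*-monoˡ-≤ (suc b) (ℕ.m≤m+n x (t (1 ℕ.+ j)))) (ℕ.m≤n+m _ (x ℕ.* suc a))) head<)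
  c-bound : suc c ℕ.≤ n
  c-bound = subst (suc c ℕ.≤_) (sym n≡)
    (ℕ.≤-trans (ℕ.m≤n*m (suc c) z {{ℕ.>-nonZero (t≥1 (1 ℕ.+ j))}}) (ℕ.m≤n+m _ (x ℕ.* suc a ℕ.+ y ℕ.* suc b)))

Ends : ℕ → ℕ → Triple → Set
Ends j n x = entry x (3 ℕ.+ j) ≡ + n

-- By `entry-bounds` the box with sides `upTo n` contains every solution.
solutions : ℕ → ℕ → List Triple
solutions j n = filter (λ x → entry x (3 ℕ.+ j) ℤ.≟ + n)
  (cartesianProduct (upTo n) (cartesianProduct (upTo n) (upTo n)))

solutions-unique : ∀ j n → Unique (solutions j n)
solutions-unique j n = Unique.filter⁺ (λ x → entry x (3 ℕ.+ j) ℤ.≟ + n)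
  (Unique.cartesianProduct⁺ (Unique.upTo⁺ n) (Unique.cartesianProduct⁺ (Unique.upTo⁺ n) (Unique.upTo⁺ n)))

∈-solutions⁻ : ∀ j n {x} → x ∈ solutions j n → Ends j n x
∈-solutions⁻ j n x∈ = proj₂ (∈-filter⁻ (λ x → entry x (3 ℕ.+ j) ℤ.≟ + n)
  {xs = cartesianProduct (upTo n) (cartesianProduct (upTo n) (upTo n))} x∈)

∈-solutions⁺ : ∀ j n {x} → Ends j n x → x ∈ solutions j n
∈-solutions⁺ j n {a , b , c} end with entry-bounds a b c j n end
... | ha , hb , hc = ∈-filter⁺ (λ x → entry x (3 ℕ.+ j) ℤ.≟ + n)
  (∈-cartesianProduct⁺ (∈-upTo⁺ (small ha)) (∈-cartesianProduct⁺ (∈-upTo⁺ (small hb)) (∈-upTo⁺ hc))) end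
  where
  small : ∀ {a} → suc a ℕ.* t (2 ℕ.+ j) ℕ.< n → a ℕ.< n
  small {a} h = ℕ.≤-trans (ℕ.m≤m*n (suc a) (t (2 ℕ.+ j)) {{ℕ.>-nonZero (t≥1 j)}}) (ℕ.<⇒≤ h)

solutions-bound : ∀ {K L} j n N .{{_ : ℕ.NonZero n}} → 2304 ℕ.* L ℕ.< K ℕ.* K → 1 ℕ.≤ N →
  (K ℕ.* n) ℕ.* (K ℕ.* n) ℕ.≤
    N ℕ.* N ℕ.* (L ℕ.* (t (4 ℕ.+ j) ℕ.* t (4 ℕ.+ j) ℕ.* t (4 ℕ.+ j))) →
  length (solutions j n) ℕ.≤ N ℕ.* N
solutions-bound {K} {L} j n N L<K² N≥1 hn = unique-length≤ (solutions-unique j n) cell cell-injective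
  where
  M = t (2 ℕ.+ j) ℕ.* N
  index : ∀ a → suc a ℕ.* t (2 ℕ.+ j) ℕ.< n → Fin N
  index a h = Fin.fromℕ< (ℕ.m<n*o⇒m/o<n {suc a ℕ.* M} {N} {n}
    (subst₂ ℕ._<_ (ℕ.*-assoc (suc a) (t (2 ℕ.+ j)) N) (ℕ.*-comm n N)
      (ℕ.*-monoˡ-< N {{ℕ.>-nonZero N≥1}} h)))
  toℕ-index : ∀ a h → toℕ (index a h) ≡ (suc a ℕ.* M) / n
  toℕ-index a h = Fin.toℕ-fromℕ< _
  index-close : ∀ a a′ h h′ → index a h ≡ index a′ h′ → ℤ.∣ + suc a ℤ.- + suc a′ ∣ ℕ.* M ℕ.≤ n
  index-close a a′ h h′ eq = quotient-close (suc a) (suc a′) M n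
    (trans (sym (toℕ-index a h)) (trans (cong toℕ eq) (toℕ-index a′ h′)))
  bounds : ∀ x → x ∈ solutions j n → _
  bounds (a , b , c) x∈ = entry-bounds a b c j n (∈-solutions⁻ j n x∈)
  cell : ∀ x → x ∈ solutions j n → Fin (N ℕ.* N)
  cell x@(a , b , c) x∈ = Fin.combine (index a (proj₁ (bounds x x∈))) (index b (proj₁ (proj₂ (bounds x x∈))))
  unsuc : ∀ {a b} → + suc a ℤ.- + suc b ≡ 0ℤ → a ≡ b
  unsuc eq = ℕ.suc-injective (ℤ.+-injective (ℤ.i-j≡0⇒i≡j _ _ eq))
  cell-injective : ∀ x y (x∈ : x ∈ solutions j n) (y∈ : y ∈ solutions j n) → cell x x∈ ≡ cell y y∈ → x ≡ y
  cell-injective x@(a , b , c) y@(a′ , b′ , c′) x∈ y∈ eq =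
    cong₂ _,_ (unsuc (proj₁ same)) (cong₂ _,_ (unsuc (proj₁ (proj₂ same))) (unsuc (proj₂ (proj₂ same))))
    where
    eqs = Fin.combine-injective
      (index a (proj₁ (bounds x x∈))) (index b (proj₁ (proj₂ (bounds x x∈))))
      (index a′ (proj₁ (bounds y y∈))) (index b′ (proj₁ (proj₂ (bounds y y∈)))) eq
    end : trib (+ suc a ℤ.- + suc a′) (+ suc b ℤ.- + suc b′) (+ suc c ℤ.- + suc c′) (3 ℕ.+ j) ≡ 0ℤ
    end = trans (sym (trib-minus (+ suc a) (+ suc b) (+ suc c) (+ suc a′) (+ suc b′) (+ suc c′) (3 ℕ.+ j)))
      (ℤ.i≡j⇒i-j≡0 (trans (∈-solutions⁻ j n x∈) (sym (∈-solutions⁻ j n y∈))))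
    same = lattice-sparse {K} {L} j {N} {n} (+ suc a ℤ.- + suc a′) (+ suc b ℤ.- + suc b′) (+ suc c ℤ.- + suc c′)
      end L<K² N≥1
      (index-close a a′ (proj₁ (bounds x x∈)) (proj₁ (bounds y y∈)) (proj₁ eqs))
      (index-close b b′ (proj₁ (proj₂ (bounds x x∈))) (proj₁ (proj₂ (bounds y y∈))) (proj₂ eqs)) hn

solutions-cardinality : ∀ j n → HasCardinality (PositiveTribonacci (4 ℕ.+ j) n) (length (solutions j n))
solutions-cardinality j n = map (toVec k) (solutions j n) ,
  Unique.map⁺ (toVec-injective (1 ℕ.+ j)) (solutions-unique j n) ,
  (λ v → mk⇔ (sound v) (complete v)) ,
  List.length-map (toVec k) (solutions j n)
  where
  -- Counted from 0, the last position is `3 + j`, the index used in `Ends`.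
  k = 4 ℕ.+ j
  lookup-toVec : ∀ x i → lookup (toVec k x) i ≡ entry x (toℕ i)
  lookup-toVec (a , b , c) = lookup∘tabulate (λ i → entry (a , b , c) (toℕ i))
  entry-pos : ∀ x m → m ℕ.< 3 → + 0 ℤ.< entry x m
  entry-pos x 0 _ = ℤ.+<+ (ℕ.s≤s ℕ.z≤n)
  entry-pos x 1 _ = ℤ.+<+ (ℕ.s≤s ℕ.z≤n)
  entry-pos x 2 _ = ℤ.+<+ (ℕ.s≤s ℕ.z≤n)
  entry-pos x (suc (suc (suc _))) (ℕ.s≤s (ℕ.s≤s (ℕ.s≤s ())))
  sound : ∀ v → v ∈ map (toVec k) (solutions j n) → PositiveTribonacci k n v
  sound v v∈ with ∈-map⁻ (toVec k) v∈
  ... | x@(a , b , c) , x∈ , refl =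
    trib-isTribonacci k (+ suc a) (+ suc b) (+ suc c) ,
    (λ i i<3 → subst (+ 0 ℤ.<_) (sym (lookup-toVec x i)) (entry-pos x (toℕ i) i<3)) ,
    (λ i i≡ → trans (lookup-toVec x i)
      (trans (cong (entry x) (ℕ.suc-injective i≡)) (∈-solutions⁻ j n x∈)))
  pred⁺ : ∀ i → + 0 ℤ.< i → ∃[ a ] (i ≡ + suc a)
  pred⁺ (+ zero)  (ℤ.+<+ ())
  pred⁺ (+ suc a) _ = a , refl
  complete : ∀ v → PositiveTribonacci k n v → v ∈ map (toVec k) (solutions j n)
  complete v (trib-v , pos-v , end-v) = subst (_∈ map (toVec k) (solutions j n)) (sym v≡)
    (∈-map⁺ (toVec k) (∈-solutions⁺ j n {x} end))
    where
    first = pred⁺ (lookup v Fin.zero) (pos-v _ (ℕ.s≤s ℕ.z≤n))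
    second = pred⁺ (lookup v (Fin.suc Fin.zero)) (pos-v _ (ℕ.s≤s (ℕ.s≤s ℕ.z≤n)))
    third = pred⁺ (lookup v (Fin.suc (Fin.suc Fin.zero))) (pos-v _ (ℕ.s≤s (ℕ.s≤s (ℕ.s≤s ℕ.z≤n))))
    x = proj₁ first , proj₁ second , proj₁ third
    init : ∀ i → toℕ i ℕ.< 3 → lookup v i ≡ lookup (toVec k x) i
    init Fin.zero _ = proj₂ first
    init (Fin.suc Fin.zero) _ = proj₂ second
    init (Fin.suc (Fin.suc Fin.zero)) _ = proj₂ third
    init (Fin.suc (Fin.suc (Fin.suc i))) (ℕ.s≤s (ℕ.s≤s (ℕ.s≤s ())))
    v≡ : v ≡ toVec k x
    v≡ = isTribonacci-unique v (toVec k x) trib-v (trib-isTribonacci k _ _ _) init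
    last : Fin k
    last = Fin.fromℕ (3 ℕ.+ j)
    end : Ends j n x
    end = begin
      entry x (3 ℕ.+ j)        ≡⟨ cong (entry x) (sym (Fin.toℕ-fromℕ (3 ℕ.+ j))) ⟩
      entry x (toℕ last)       ≡⟨ sym (lookup-toVec x last) ⟩
      lookup (toVec k x) last  ≡⟨ cong (λ w → lookup w last) (sym v≡) ⟩
      lookup v last            ≡⟨ end-v last (cong suc (Fin.toℕ-fromℕ (3 ℕ.+ j))) ⟩
      + n                      ∎
      where open ≡-Reasoning

-- Powers of φ and the ceiling

-- Definitionally every term of the constant sequence `fromℤ i`.
ι : ℤ → ℚ
ι i = i ℚ./ 1

-- Passing to unnormalised fractions fixes the denominator at 1, so facts about `ι` reduce to
-- integer arithmetic.
ι≃ : ∀ i → ℚ.toℚᵘ (ι i) ℚᵘ.≃ ℚᵘ.mkℚᵘ i 0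
ι≃ i = ℚ.toℚᵘ-fromℚᵘ (ℚᵘ.mkℚᵘ i 0)

ι-+ : ∀ i j → ι (i ℤ.+ j) ≡ ι i ℚ.+ ι j
ι-+ i j = ℚ.toℚᵘ-injective (let open ℚᵘ.≃-Reasoning in begin
  ℚ.toℚᵘ (ι (i ℤ.+ j))                     ≈⟨ ι≃ (i ℤ.+ j) ⟩
  ℚᵘ.mkℚᵘ (i ℤ.+ j) 0                      ≈⟨ ℚᵘ.*≡* (lem i j) ⟩
  ℚᵘ.mkℚᵘ i 0 ℚᵘ.+ ℚᵘ.mkℚᵘ j 0             ≈⟨ ℚᵘ.+-cong (ℚᵘ.≃-sym (ι≃ i)) (ℚᵘ.≃-sym (ι≃ j)) ⟩
  ℚ.toℚᵘ (ι i) ℚᵘ.+ ℚ.toℚᵘ (ι j)           ≈⟨ ℚᵘ.≃-sym (ℚ.toℚᵘ-homo-+ (ι i) (ι j)) ⟩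
  ℚ.toℚᵘ (ι i ℚ.+ ι j)                     ∎)
  where
  lem : ∀ i j → (i ℤ.+ j) ℤ.* + 1 ≡ (i ℤ.* + 1 ℤ.+ j ℤ.* + 1) ℤ.* + 1
  lem = ℤRing.solve-∀

ι-* : ∀ i j → ι (i ℤ.* j) ≡ ι i ℚ.* ι j
ι-* i j = ℚ.toℚᵘ-injective (let open ℚᵘ.≃-Reasoning in begin
  ℚ.toℚᵘ (ι (i ℤ.* j))                     ≈⟨ ι≃ (i ℤ.* j) ⟩
  ℚᵘ.mkℚᵘ i 0 ℚᵘ.* ℚᵘ.mkℚᵘ j 0             ≈⟨ ℚᵘ.*-cong (ℚᵘ.≃-sym (ι≃ i)) (ℚᵘ.≃-sym (ι≃ j)) ⟩
  ℚ.toℚᵘ (ι i) ℚᵘ.* ℚ.toℚᵘ (ι j)           ≈⟨ ℚᵘ.≃-sym (ℚ.toℚᵘ-homo-* (ι i) (ι j)) ⟩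
  ℚ.toℚᵘ (ι i ℚ.* ι j)                     ∎)

ι-ℕ* : ∀ m n → ι (+ (m ℕ.* n)) ≡ ι (+ m) ℚ.* ι (+ n)
ι-ℕ* m n = trans (cong ι (ℤ.pos-* m n)) (ι-* (+ m) (+ n))

ι-mono : ∀ {i j} → i ℤ.≤ j → ι i ℚ.≤ ι j
ι-mono {i} {j} i≤j = ℚ.toℚᵘ-cancel-≤ (let open ℚᵘ.≤-Reasoning in begin
  ℚ.toℚᵘ (ι i)   ≃⟨ ι≃ i ⟩
  ℚᵘ.mkℚᵘ i 0    ≤⟨ ℚᵘ.*≤* (ℤ.*-monoʳ-≤-nonNeg (+ 1) i≤j) ⟩
  ℚᵘ.mkℚᵘ j 0    ≃⟨ ℚᵘ.≃-sym (ι≃ j) ⟩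
  ℚ.toℚᵘ (ι j)   ∎)

ι-cancel : ∀ {i j} → ι i ℚ.≤ ι j → i ℤ.≤ j
ι-cancel {i} {j} h = cancel (let open ℚᵘ.≤-Reasoning in begin
  ℚᵘ.mkℚᵘ i 0    ≃⟨ ℚᵘ.≃-sym (ι≃ i) ⟩
  ℚ.toℚᵘ (ι i)   ≤⟨ ℚ.toℚᵘ-mono-≤ h ⟩
  ℚ.toℚᵘ (ι j)   ≃⟨ ι≃ j ⟩
  ℚᵘ.mkℚᵘ j 0    ∎)
  where
  cancel : ℚᵘ.mkℚᵘ i 0 ℚᵘ.≤ ℚᵘ.mkℚᵘ j 0 → i ℤ.≤ j
  cancel (ℚᵘ.*≤* e) = ℤ.*-cancelʳ-≤-pos i j (+ 1) e

0≤* : ∀ {p q} → 0ℚ ℚ.≤ p → 0ℚ ℚ.≤ q → 0ℚ ℚ.≤ p ℚ.* q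
0≤* {p} {q} 0≤p 0≤q = subst (ℚ._≤ p ℚ.* q) (ℚ.*-zeroˡ q)
  (ℚ.*-monoʳ-≤-nonNeg q {{ℚ.nonNegative 0≤q}} 0≤p)

*-mono : ∀ {p q r s} → 0ℚ ℚ.≤ r → 0ℚ ℚ.≤ q → p ℚ.≤ q → r ℚ.≤ s → p ℚ.* r ℚ.≤ q ℚ.* s
*-mono {p} {q} {r} {s} 0≤r 0≤q p≤q r≤s = ℚ.≤-trans
  (ℚ.*-monoʳ-≤-nonNeg r {{ℚ.nonNegative 0≤r}} p≤q) (ℚ.*-monoˡ-≤-nonNeg q {{ℚ.nonNegative 0≤q}} r≤s)

p≤∣p∣ : ∀ p → p ℚ.≤ ∣ p ∣
p≤∣p∣ p with ℚ.≤-total 0ℚ p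
... | inj₁ 0≤p = ℚ.≤-reflexive (sym (ℚ.0≤p⇒∣p∣≡p 0≤p))
... | inj₂ p≤0 = ℚ.≤-trans p≤0 (ℚ.0≤∣p∣ p)

≤+∣-∣ : ∀ {p q ε} → ∣ p ℚ.- q ∣ ℚ.< ε → p ℚ.≤ q ℚ.+ ε
≤+∣-∣ {p} {q} {ε} h = subst (ℚ._≤ q ℚ.+ ε) (lem p q)
  (ℚ.+-monoʳ-≤ q (ℚ.≤-trans (p≤∣p∣ (p ℚ.- q)) (ℚ.<⇒≤ h)))
  where
  lem : ∀ p q → q ℚ.+ (p ℚ.- q) ≡ p
  lem = solve 2 (λ p q → q :+ (p :- q) := p) refl
    where open +-*-Solver

-- The tolerance for an approximate root: for `0 ≤ p ≤ 2` it outweighs the growth of the powers of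
-- `p` up to exponent `k`.
halfPow : ℕ → ℚ
halfPow zero    = 1ℚ
halfPow (suc k) = ½ ℚ.* halfPow k

halfPow-pos : ∀ k → 0ℚ ℚ.< halfPow k
halfPow-pos zero    = ℚ.positive⁻¹ 1ℚ
halfPow-pos (suc k) = subst (ℚ._< ½ ℚ.* halfPow k) (ℚ.*-zeroʳ ½) (ℚ.*-monoʳ-<-pos ½ (halfPow-pos k))

halfPow≤1 : ∀ k → halfPow k ℚ.≤ 1ℚ
halfPow≤1 zero    = ℚ.≤-refl
halfPow≤1 (suc k) = ℚ.≤-trans (ℚ.*-monoˡ-≤-nonNeg ½ (halfPow≤1 k)) (ℚ.≤ᵇ⇒≤ {½ ℚ.* 1ℚ} {1ℚ} _)

<⇒≱ : ∀ {p q} → p ℚ.< q → ¬ q ℚ.≤ p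
<⇒≱ p<q q≤p = ℚ.<-irrefl refl (ℚ.<-≤-trans p<q q≤p)

-- Spelled with the units that seq (φ ^ 3) and seq (φ ^ 2) carry.
χ : ℚ → ℚ
χ p = p ℚ.* (p ℚ.* (p ℚ.* 1ℚ)) ℚ.- (p ℚ.* (p ℚ.* 1ℚ) ℚ.+ p ℚ.* 1ℚ ℚ.+ 1ℚ)

2ℚ : ℚ
2ℚ = 1ℚ ℚ.+ 1ℚ

-- Since `χ p = (p − 2)(p² + p + 1) + 1`, any `p ≥ 2` has `χ p ≥ 1`, beyond the tolerance.
near-root≤2 : ∀ {p} → ∣ χ p ∣ ℚ.< ½ → p ℚ.≤ 2ℚ
near-root≤2 {p} h with ℚ.≤-total p 2ℚ
... | inj₁ p≤2 = p≤2
... | inj₂ 2≤p = ⊥-elim (<⇒≱ (ℚ.<-≤-trans h (ℚ.≤ᵇ⇒≤ {½} {1ℚ} _)) (let open ℚ.≤-Reasoning in begin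
  1ℚ                            ≡⟨ sym (ℚ.+-identityˡ 1ℚ) ⟩
  0ℚ ℚ.+ 1ℚ                     ≤⟨ ℚ.+-monoˡ-≤ 1ℚ (0≤* 0≤p-2 (ℚ.+-mono-≤ (ℚ.+-mono-≤ (0≤* 0≤p 0≤p) 0≤p) 0≤1)) ⟩
  (p ℚ.- 2ℚ) ℚ.* (p ℚ.* p ℚ.+ p ℚ.+ 1ℚ) ℚ.+ 1ℚ  ≡⟨ lem p ⟩
  χ p                        ≤⟨ p≤∣p∣ (χ p) ⟩
  ∣ χ p ∣                    ∎))
  where
  0≤1 : 0ℚ ℚ.≤ 1ℚ
  0≤1 = ℚ.≤ᵇ⇒≤ _
  0≤p : 0ℚ ℚ.≤ p
  0≤p = ℚ.≤-trans (ℚ.≤ᵇ⇒≤ _) 2≤p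
  0≤p-2 : 0ℚ ℚ.≤ p ℚ.- 2ℚ
  0≤p-2 = subst (ℚ._≤ p ℚ.- 2ℚ) (ℚ.+-inverseʳ 2ℚ) (ℚ.+-monoˡ-≤ (ℚ.- 2ℚ) 2≤p)
  open +-*-Solver
  lem : ∀ p → (p ℚ.- 2ℚ) ℚ.* (p ℚ.* p ℚ.+ p ℚ.+ 1ℚ) ℚ.+ 1ℚ ≡ χ p
  lem = solve 1 (λ p → (p :- con 2ℚ) :* (p :* p :+ p :+ con 1ℚ) :+ con 1ℚ :=
    p :* (p :* (p :* con 1ℚ)) :- (p :* (p :* con 1ℚ) :+ p :* con 1ℚ :+ con 1ℚ)) refl

0≤p² : ∀ p → 0ℚ ℚ.≤ p ℚ.* p
0≤p² p = subst (0ℚ ℚ.≤_) (∣p∣²≡p² p) (0≤* (ℚ.0≤∣p∣ p) (ℚ.0≤∣p∣ p))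
  where
  open +-*-Solver
  neg² : ∀ p → (ℚ.- p) ℚ.* (ℚ.- p) ≡ p ℚ.* p
  neg² = solve 1 (λ p → (:- p) :* (:- p) := p :* p) refl
  ∣p∣²≡p² : ∀ p → ∣ p ∣ ℚ.* ∣ p ∣ ≡ p ℚ.* p
  ∣p∣²≡p² p with ℚ.∣p∣≡p∨∣p∣≡-p p
  ... | inj₁ e = cong₂ ℚ._*_ e e
  ... | inj₂ e = trans (cong₂ ℚ._*_ e e) (neg² p)

¼ : ℚ
¼ = ½ ℚ.* ½

-- For `r = − p ≥ 0` one has `− χ p = r³ + (r − ½)² + ¾`, beyond the tolerance.
0≤near-root : ∀ {p} → ∣ χ p ∣ ℚ.< ½ → 0ℚ ℚ.≤ p
0≤near-root {p} h with ℚ.≤-total 0ℚ p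
... | inj₁ 0≤p = 0≤p
... | inj₂ p≤0 = ⊥-elim (<⇒≱ h (let open ℚ.≤-Reasoning in begin
  ½                                    ≡⟨ sym (ℚ.+-identityˡ ½) ⟩
  0ℚ ℚ.+ ½                             ≤⟨ ℚ.+-monoˡ-≤ ½
      (ℚ.+-mono-≤ (ℚ.+-mono-≤ (0≤* 0≤r (0≤p² r)) (0≤p² (r ℚ.- ½))) (ℚ.≤ᵇ⇒≤ {0ℚ} {¼} _)) ⟩
  r ℚ.* (r ℚ.* r) ℚ.+ (r ℚ.- ½) ℚ.* (r ℚ.- ½) ℚ.+ ¼ ℚ.+ ½  ≡⟨ lem p ⟩
  ℚ.- χ p                           ≤⟨ p≤∣p∣ (ℚ.- χ p) ⟩
  ∣ ℚ.- χ p ∣                       ≡⟨ ℚ.∣-p∣≡∣p∣ (χ p) ⟩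
  ∣ χ p ∣                           ∎))
  where
  r = ℚ.- p
  0≤r : 0ℚ ℚ.≤ r
  0≤r = ℚ.neg-antimono-≤ p≤0
  open +-*-Solver
  lem : ∀ p → let r = ℚ.- p in
    r ℚ.* (r ℚ.* r) ℚ.+ (r ℚ.- ½) ℚ.* (r ℚ.- ½) ℚ.+ ¼ ℚ.+ ½ ≡ ℚ.- χ p
  lem = solve 1 (λ p → let r = :- p in
    r :* (r :* r) :+ (r :- con ½) :* (r :- con ½) :+ con ¼ :+ con ½ :=
    :- (p :* (p :* (p :* con 1ℚ)) :- (p :* (p :* con 1ℚ) :+ p :* con 1ℚ :+ con 1ℚ))) refl

-- Powers of one rational approximation to φ against tribonacci numbers

module _ (φ : ℝ) (i : ℕ) where

  private
    p : ℚ
    p = seq φ i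
    q : ℕ → ℚ
    q j = seq (φ ^ j) i

  pow-+ : ∀ m n → q (m ℕ.+ n) ≡ q m ℚ.* q n
  pow-+ zero    n = sym (ℚ.*-identityˡ (q n))
  pow-+ (suc m) n = trans (cong (p ℚ.*_) (pow-+ m n)) (sym (ℚ.*-assoc p (q m) (q n)))

  pow-3 : ∀ k → q (3 ℕ.* k) ≡ q k ℚ.* (q k ℚ.* q k)
  pow-3 k = trans (pow-+ k (k ℕ.+ (k ℕ.+ 0)))
    (cong (q k ℚ.*_) (trans (pow-+ k (k ℕ.+ 0)) (cong (λ l → q k ℚ.* q l) (ℕ.+-identityʳ k))))

  module _ (0≤p : 0ℚ ℚ.≤ p) (p≤2 : p ℚ.≤ 2ℚ) where

    0≤pow : ∀ j → 0ℚ ℚ.≤ q j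
    0≤pow zero    = ℚ.≤ᵇ⇒≤ _
    0≤pow (suc j) = 0≤* 0≤p (0≤pow j)

    pow≤ : ∀ j → q j ℚ.≤ seq (fromℕ 2 ^ j) i
    pow≤ zero    = ℚ.≤-refl
    pow≤ (suc j) = *-mono (0≤pow j) (ℚ.≤ᵇ⇒≤ {0ℚ} {2ℚ} _) p≤2 (pow≤ j)

    -- Each factor `p ≤ 2` is paired with a factor `½`.
    pow*halfPow≤1 : ∀ {j k} → j ℕ.≤ k → q j ℚ.* halfPow k ℚ.≤ 1ℚ
    pow*halfPow≤1 {k = k} ℕ.z≤n = subst (ℚ._≤ 1ℚ) (sym (ℚ.*-identityˡ (halfPow k))) (halfPow≤1 k)
    pow*halfPow≤1 {suc j} {suc k} (ℕ.s≤s j≤k) = subst (ℚ._≤ 1ℚ) (sym (lem p (q j) ½ (halfPow k)))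
      (*-mono {q = 1ℚ} (0≤* (0≤pow j) (ℚ.<⇒≤ (halfPow-pos k))) (ℚ.≤ᵇ⇒≤ _)
        (ℚ.*-monoʳ-≤-nonNeg ½ p≤2) (pow*halfPow≤1 j≤k))
      where
      lem : ∀ p q h k → p ℚ.* q ℚ.* (h ℚ.* k) ≡ p ℚ.* h ℚ.* (q ℚ.* k)
      lem = solve 4 (λ p q h k → p :* q :* (h :* k) := p :* h :* (q :* k)) refl
        where open +-*-Solver

    -- The summands 1 on both sides absorb the error made because p is only an
    -- approximate root.
    pow-step : ∀ {j k} → j ℕ.≤ k → ∣ χ p ∣ ℚ.< halfPow k →
      q (3 ℕ.+ j) ℚ.+ 1ℚ ℚ.≤ (q (2 ℕ.+ j) ℚ.+ 1ℚ) ℚ.+ (q (1 ℕ.+ j) ℚ.+ 1ℚ) ℚ.+ (q j ℚ.+ 1ℚ)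
    pow-step {j} {k} j≤k h = let open ℚ.≤-Reasoning in begin
      q (3 ℕ.+ j) ℚ.+ 1ℚ                                                     ≡⟨ lem₁ p a ⟩
      p ℚ.* (p ℚ.* a) ℚ.+ p ℚ.* a ℚ.+ a ℚ.+ (a ℚ.* χ p ℚ.+ 1ℚ)
        ≤⟨ ℚ.+-monoʳ-≤ (p ℚ.* (p ℚ.* a) ℚ.+ p ℚ.* a ℚ.+ a) (ℚ.+-monoˡ-≤ 1ℚ small) ⟩
      p ℚ.* (p ℚ.* a) ℚ.+ p ℚ.* a ℚ.+ a ℚ.+ 2ℚ
        ≤⟨ ℚ.+-monoʳ-≤ (p ℚ.* (p ℚ.* a) ℚ.+ p ℚ.* a ℚ.+ a) (ℚ.≤ᵇ⇒≤ {2ℚ} {2ℚ ℚ.+ 1ℚ} _) ⟩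
      p ℚ.* (p ℚ.* a) ℚ.+ p ℚ.* a ℚ.+ a ℚ.+ (2ℚ ℚ.+ 1ℚ)                       ≡⟨ lem₂ (q (2 ℕ.+ j)) (q (1 ℕ.+ j)) a ⟩
      (q (2 ℕ.+ j) ℚ.+ 1ℚ) ℚ.+ (q (1 ℕ.+ j) ℚ.+ 1ℚ) ℚ.+ (a ℚ.+ 1ℚ)            ∎
      where
      a = q j
      small : a ℚ.* χ p ℚ.≤ 1ℚ
      small = ℚ.≤-trans
        (ℚ.*-monoˡ-≤-nonNeg a {{ℚ.nonNegative (0≤pow j)}} (ℚ.≤-trans (p≤∣p∣ (χ p)) (ℚ.<⇒≤ h)))
        (pow*halfPow≤1 j≤k)
      open +-*-Solver
      lem₁ : ∀ p a → p ℚ.* (p ℚ.* (p ℚ.* a)) ℚ.+ 1ℚ ≡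
        p ℚ.* (p ℚ.* a) ℚ.+ p ℚ.* a ℚ.+ a ℚ.+ (a ℚ.* χ p ℚ.+ 1ℚ)
      lem₁ = solve 2 (λ p a → p :* (p :* (p :* a)) :+ con 1ℚ :=
        p :* (p :* a) :+ p :* a :+ a :+
        (a :* (p :* (p :* (p :* con 1ℚ)) :- (p :* (p :* con 1ℚ) :+ p :* con 1ℚ :+ con 1ℚ)) :+ con 1ℚ)) refl
      lem₂ : ∀ x y a → x ℚ.+ y ℚ.+ a ℚ.+ (2ℚ ℚ.+ 1ℚ) ≡ (x ℚ.+ 1ℚ) ℚ.+ (y ℚ.+ 1ℚ) ℚ.+ (a ℚ.+ 1ℚ)
      lem₂ = solve 3 (λ x y a → x :+ y :+ a :+ con (2ℚ ℚ.+ 1ℚ) :=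
        (x :+ con 1ℚ) :+ (y :+ con 1ℚ) :+ (a :+ con 1ℚ)) refl

    -- The constant 9 comes from the initial cases under `p ≤ 2`: they need 5 ≤ 9, 9 ≤ 9 and 17 ≤
    -- 18, the second being tight.
    pow≤t : ∀ {k} j → 2 ℕ.+ j ℕ.≤ k → ∣ χ p ∣ ℚ.< halfPow k →
      q (2 ℕ.+ j) ℚ.+ 1ℚ ℚ.≤ ι (+ (9 ℕ.* t (2 ℕ.+ j)))
    pow≤t 0 _ _ = ℚ.≤-trans (ℚ.+-monoˡ-≤ 1ℚ (pow≤ 2)) (ℚ.≤ᵇ⇒≤ _)
    pow≤t 1 _ _ = ℚ.≤-trans (ℚ.+-monoˡ-≤ 1ℚ (pow≤ 3)) (ℚ.≤ᵇ⇒≤ _)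
    pow≤t 2 _ _ = ℚ.≤-trans (ℚ.+-monoˡ-≤ 1ℚ (pow≤ 4)) (ℚ.≤ᵇ⇒≤ _)
    pow≤t {k} (suc (suc (suc j))) 5+j≤k h = let open ℚ.≤-Reasoning in begin
      q (5 ℕ.+ j) ℚ.+ 1ℚ      ≤⟨ pow-step (ℕ.m+n≤o⇒n≤o 3 5+j≤k) h ⟩
      (q (4 ℕ.+ j) ℚ.+ 1ℚ) ℚ.+ (q (3 ℕ.+ j) ℚ.+ 1ℚ) ℚ.+ (q (2 ℕ.+ j) ℚ.+ 1ℚ)
        ≤⟨ ℚ.+-mono-≤ (ℚ.+-mono-≤ (pow≤t (suc (suc j)) (ℕ.m+n≤o⇒n≤o 1 5+j≤k) h)
             (pow≤t (suc j) (ℕ.m+n≤o⇒n≤o 2 5+j≤k) h)) (pow≤t j (ℕ.m+n≤o⇒n≤o 3 5+j≤k) h) ⟩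
      ι (+ (9 ℕ.* t (4 ℕ.+ j))) ℚ.+ ι (+ (9 ℕ.* t (3 ℕ.+ j))) ℚ.+ ι (+ (9 ℕ.* t (2 ℕ.+ j)))
        ≡⟨ cong (ℚ._+ ι (+ (9 ℕ.* t (2 ℕ.+ j)))) (sym (ι-+ (+ (9 ℕ.* t (4 ℕ.+ j))) (+ (9 ℕ.* t (3 ℕ.+ j))))) ⟩
      ι (+ (9 ℕ.* t (4 ℕ.+ j) ℕ.+ 9 ℕ.* t (3 ℕ.+ j))) ℚ.+ ι (+ (9 ℕ.* t (2 ℕ.+ j)))
        ≡⟨ sym (ι-+ (+ (9 ℕ.* t (4 ℕ.+ j) ℕ.+ 9 ℕ.* t (3 ℕ.+ j))) (+ (9 ℕ.* t (2 ℕ.+ j)))) ⟩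
      ι (+ (9 ℕ.* t (4 ℕ.+ j) ℕ.+ 9 ℕ.* t (3 ℕ.+ j) ℕ.+ 9 ℕ.* t (2 ℕ.+ j)))
        ≡⟨ cong (λ m → ι (+ m)) (lem (t (4 ℕ.+ j)) (t (3 ℕ.+ j)) (t (2 ℕ.+ j))) ⟩
      ι (+ (9 ℕ.* t (5 ℕ.+ j))) ∎
      where
      lem : ∀ x y z → 9 ℕ.* x ℕ.+ 9 ℕ.* y ℕ.+ 9 ℕ.* z ≡ 9 ℕ.* (x ℕ.+ y ℕ.+ z)
      lem = ℕRing.solve-∀

-- From the real ceiling to an inequality between natural numbers

1≤ι : ∀ n → 1 ℕ.≤ n → 1ℚ ℚ.≤ ι (+ n)
1≤ι n h = ι-mono {+ 1} {+ n} (ℤ.+≤+ h)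

-- Here `r` will be the maximum with `ε` inverted in `inv-seq`, and `s` the term of the sequence
-- that it eventually equals.
1/-inverse : ∀ r s .{{_ : ℚ.NonZero r}} → r ≡ s → (ℚ.1/ r) ℚ.* s ≡ 1ℚ
1/-inverse r .r refl = ℚ.*-inverseˡ r

-- The loss from K + 1 to K pays for the error 1 of the rational approximations.
ceiling-numerator : ∀ {K n E} (N : ℤ) {σ} → 1 ℕ.≤ K → 1 ℕ.≤ n → 0ℚ ℚ.< σ →
  σ ℚ.* σ ℚ.≤ ι (+ E) → ι (+ (suc K ℕ.* n)) ℚ.≤ ι N ℚ.* σ ℚ.+ 1ℚ →
  ∃[ m ] (N ≡ + m × 1 ℕ.≤ m × (K ℕ.* n) ℕ.* (K ℕ.* n) ℕ.≤ m ℕ.* m ℕ.* E)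
ceiling-numerator {K} {n} {E} N {σ} K≥1 n≥1 σ>0 σ²≤E h = positive N Kn≤
  where
  cancel-1 : ∀ {p q} → p ℚ.+ 1ℚ ℚ.≤ q ℚ.+ 1ℚ → p ℚ.≤ q
  cancel-1 {p} {q} h = subst₂ ℚ._≤_ (lem p) (lem q) (ℚ.+-monoˡ-≤ (ℚ.- 1ℚ) h)
    where
    lem : ∀ p → p ℚ.+ 1ℚ ℚ.+ (ℚ.- 1ℚ) ≡ p
    lem = solve 1 (λ p → p :+ con 1ℚ :+ (:- con 1ℚ) := p) refl
      where open +-*-Solver
  Kn≤ : ι (+ (K ℕ.* n)) ℚ.≤ ι N ℚ.* σ
  Kn≤ = cancel-1 (let open ℚ.≤-Reasoning in begin
    ι (+ (K ℕ.* n)) ℚ.+ 1ℚ          ≤⟨ ℚ.+-monoʳ-≤ (ι (+ (K ℕ.* n))) (1≤ι n n≥1) ⟩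
    ι (+ (K ℕ.* n)) ℚ.+ ι (+ n)     ≡⟨ sym (ι-+ (+ (K ℕ.* n)) (+ n)) ⟩
    ι (+ (K ℕ.* n ℕ.+ n))           ≡⟨ cong (λ l → ι (+ l)) (ℕ.+-comm (K ℕ.* n) n) ⟩
    ι (+ (suc K ℕ.* n))             ≤⟨ h ⟩
    ι N ℚ.* σ ℚ.+ 1ℚ                ∎)
  Kn≥1 : 1ℚ ℚ.≤ ι (+ (K ℕ.* n))
  Kn≥1 = 1≤ι (K ℕ.* n) (ℕ.*-mono-≤ K≥1 n≥1)
  0≤σ : 0ℚ ℚ.≤ σ
  0≤σ = ℚ.<⇒≤ σ>0
  -- As `K n ≥ 1`, only a positive `N` is possible; it can then serve as a number of cells.
  nonpositive : ∀ N → N ℤ.≤ + 0 → ι (+ (K ℕ.* n)) ℚ.≤ ι N ℚ.* σ → ∀ {A : Set} → A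
  nonpositive N N≤0 h = ⊥-elim (<⇒≱ (ℚ.positive⁻¹ 1ℚ) (let open ℚ.≤-Reasoning in begin
    1ℚ                  ≤⟨ Kn≥1 ⟩
    ι (+ (K ℕ.* n))     ≤⟨ h ⟩
    ι N ℚ.* σ           ≤⟨ ℚ.*-monoʳ-≤-nonNeg σ {{ℚ.nonNegative 0≤σ}} (ι-mono {N} {+ 0} N≤0) ⟩
    0ℚ ℚ.* σ            ≡⟨ ℚ.*-zeroˡ σ ⟩
    0ℚ                  ∎))
  positive : ∀ N → ι (+ (K ℕ.* n)) ℚ.≤ ι N ℚ.* σ →
    ∃[ m ] (N ≡ + m × 1 ℕ.≤ m × (K ℕ.* n) ℕ.* (K ℕ.* n) ℕ.≤ m ℕ.* m ℕ.* E)
  positive ℤ.-[1+ l ] h = nonpositive ℤ.-[1+ l ] ℤ.-≤+ h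
  positive (+ zero)     h = nonpositive (+ zero) (ℤ.+≤+ ℕ.z≤n) h
  positive (+ suc l)    h = suc l , refl , ℕ.s≤s ℕ.z≤n ,
    ℤ.drop‿+≤+ (ι-cancel {+ (a ℕ.* a)} {+ (m ℕ.* m ℕ.* E)} (let open ℚ.≤-Reasoning in begin
    ι (+ (a ℕ.* a))                        ≡⟨ ι-ℕ* a a ⟩
    ι (+ a) ℚ.* ι (+ a)                    ≤⟨ *-mono 0≤a (ℚ.≤-trans 0≤a h) h h ⟩
    (ι (+ m) ℚ.* σ) ℚ.* (ι (+ m) ℚ.* σ)    ≡⟨ lem (ι (+ m)) σ ⟩
    (ι (+ m) ℚ.* ι (+ m)) ℚ.* (σ ℚ.* σ)    ≤⟨ ℚ.*-monoˡ-≤-nonNeg (ι (+ m) ℚ.* ι (+ m)) {{ℚ.nonNegative (0≤p² (ι (+ m)))}} σ²≤E ⟩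
    (ι (+ m) ℚ.* ι (+ m)) ℚ.* ι (+ E)      ≡⟨ cong (ℚ._* ι (+ E)) (sym (ι-ℕ* m m)) ⟩
    ι (+ (m ℕ.* m)) ℚ.* ι (+ E)            ≡⟨ sym (ι-ℕ* (m ℕ.* m) E) ⟩
    ι (+ (m ℕ.* m ℕ.* E))                  ∎))
    where
    a = K ℕ.* n
    m = suc l
    0≤a : 0ℚ ℚ.≤ ι (+ a)
    0≤a = ι-mono {+ 0} {+ a} (ℤ.+≤+ ℕ.z≤n)
    lem : ∀ a b → (a ℚ.* b) ℚ.* (a ℚ.* b) ≡ (a ℚ.* a) ℚ.* (b ℚ.* b)
    lem = solve 2 (λ a b → (a :* b) :* (a :* b) := (a :* a) :* (b :* b)) refl
      where open +-*-Solver

-- Turns a bound on `σ²` into a bound on `σ` without a square root.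
square≤⇒≤ : ∀ {x y} → 1ℚ ℚ.≤ y → 0ℚ ℚ.≤ x → x ℚ.* x ℚ.≤ y → x ℚ.≤ y
square≤⇒≤ {x} {y} 1≤y 0≤x x²≤y with ℚ.≤-total x 1ℚ
... | inj₁ x≤1 = ℚ.≤-trans x≤1 1≤y
... | inj₂ 1≤x = let open ℚ.≤-Reasoning in begin
  x           ≡⟨ sym (ℚ.*-identityʳ x) ⟩
  x ℚ.* 1ℚ    ≤⟨ ℚ.*-monoˡ-≤-nonNeg x {{ℚ.nonNegative 0≤x}} 1≤x ⟩
  x ℚ.* x     ≤⟨ x²≤y ⟩
  y           ∎

-- One sufficiently late index realises all three asymptotic inequalities; multiplying by `σ` there
-- clears the division.
ceiling-bound : ∀ {K n E} (N : ℤ) s (s>0 : fromℕ 0 < s) → 1 ℕ.≤ K → 1 ℕ.≤ n → 1 ℕ.≤ E →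
  ∃[ M ] (∀ i → M ℕ.≤ i → seq s i ℚ.* seq s i ℚ.≤ ι (+ E)) →
  fromℕ (suc K) * (fromℕ n ÷ s [ s>0 ]) ≤ fromℤ N →
  ∃[ m ] (N ≡ + m × 1 ℕ.≤ m × (K ℕ.* n) ℕ.* (K ℕ.* n) ℕ.≤ m ℕ.* m ℕ.* E)
ceiling-bound {K} {n} {E} N s s>0@(ε , ε>0 , M₁ , s≥ε) K≥1 n≥1 E≥1 (M₂ , s²≤E) x≤N =
  ceiling-numerator {K} {n} {E} N {σ} K≥1 n≥1 (ℚ.<-≤-trans ε>0 ε≤σ) σ²≤E (let open ℚ.≤-Reasoning in begin
    ι (+ (suc K ℕ.* n))                      ≡⟨ ι-ℕ* (suc K) n ⟩
    a ℚ.* b                                  ≡⟨ sym (ℚ.*-identityʳ (a ℚ.* b)) ⟩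
    (a ℚ.* b) ℚ.* 1ℚ                         ≡⟨ cong ((a ℚ.* b) ℚ.*_) (sym v*σ≡1) ⟩
    (a ℚ.* b) ℚ.* (v ℚ.* σ)                  ≡⟨ regroup a b v σ ⟩
    (a ℚ.* (b ℚ.* v)) ℚ.* σ                  ≤⟨ ℚ.*-monoʳ-≤-nonNeg σ {{ℚ.nonNegative 0≤σ}} (proj₂ x≤N′ i M₃≤i) ⟩
    (ι N ℚ.+ δ) ℚ.* σ                        ≡⟨ ℚ.*-distribʳ-+ σ (ι N) δ ⟩
    ι N ℚ.* σ ℚ.+ δ ℚ.* σ                    ≤⟨ ℚ.+-monoʳ-≤ (ι N ℚ.* σ) δσ≤1 ⟩
    ι N ℚ.* σ ℚ.+ 1ℚ                         ∎)
  where
  F : ℚ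
  F = ι (+ E)
  F>0 : 0ℚ ℚ.< F
  F>0 = ℚ.<-≤-trans (ℚ.positive⁻¹ 1ℚ) (1≤ι E E≥1)
  instance
    F-pos : ℚ.Positive F
    F-pos = ℚ.positive F>0
    F-nonZero : ℚ.NonZero F
    F-nonZero = ℚ.>-nonZero F>0
  -- The tolerance `1 / E` is chosen because `σ ≤ E`, so the error `δ σ` is at most 1.
  δ : ℚ
  δ = ℚ.1/ F
  δ>0 : 0ℚ ℚ.< δ
  δ>0 = ℚ.positive⁻¹ δ {{ℚ.1/pos⇒pos F}}
  x≤N′ = x≤N δ δ>0
  M₃ = proj₁ x≤N′
  i = (M₁ ℕ.⊔ M₂) ℕ.⊔ M₃
  M₁≤i : M₁ ℕ.≤ i
  M₁≤i = ℕ.≤-trans (ℕ.m≤m⊔n M₁ M₂) (ℕ.m≤m⊔n (M₁ ℕ.⊔ M₂) M₃)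
  M₂≤i : M₂ ℕ.≤ i
  M₂≤i = ℕ.≤-trans (ℕ.m≤n⊔m M₁ M₂) (ℕ.m≤m⊔n (M₁ ℕ.⊔ M₂) M₃)
  M₃≤i : M₃ ℕ.≤ i
  M₃≤i = ℕ.m≤n⊔m (M₁ ℕ.⊔ M₂) M₃
  a = ι (+ suc K)
  b = ι (+ n)
  v = inv-seq s s>0 i
  σ = seq s i
  ε≤σ : ε ℚ.≤ σ
  ε≤σ = subst (ℚ._≤ σ) (ℚ.+-identityˡ ε) (s≥ε i M₁≤i)
  0≤σ : 0ℚ ℚ.≤ σ
  0≤σ = ℚ.≤-trans (ℚ.<⇒≤ ε>0) ε≤σ
  v*σ≡1 : v ℚ.* σ ≡ 1ℚ
  v*σ≡1 = 1/-inverse (σ ℚ.⊔ ε) σ {{ℚ.>-nonZero (ℚ.<-≤-trans ε>0 (ℚ.p≤q⊔p σ ε))}} (ℚ.p≥q⇒p⊔q≡p ε≤σ)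
  σ²≤E : σ ℚ.* σ ℚ.≤ F
  σ²≤E = s²≤E i M₂≤i
  σ≤F : σ ℚ.≤ F
  σ≤F = square≤⇒≤ (1≤ι E E≥1) 0≤σ σ²≤E
  δσ≤1 : δ ℚ.* σ ℚ.≤ 1ℚ
  δσ≤1 = ℚ.≤-trans (ℚ.*-monoˡ-≤-nonNeg δ {{ℚ.nonNegative (ℚ.<⇒≤ δ>0)}} σ≤F) (ℚ.≤-reflexive (ℚ.*-inverseˡ F))
  regroup : ∀ a b v σ → (a ℚ.* b) ℚ.* (v ℚ.* σ) ≡ (a ℚ.* (b ℚ.* v)) ℚ.* σ
  regroup = solve 4 (λ a b v σ → (a :* b) :* (v :* σ) := (a :* (b :* v)) :* σ) refl
    where open +-*-Solver

-- As `(q + 1)³` exceeds `q³ + 1` by `3 (q² + q)`, the spare 1 in `pow≤t` also absorbs the tolerance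
-- in comparing `s ^ 2` with the power of φ.
cube+1≤ : ∀ {q G} → 0ℚ ℚ.≤ q → q ℚ.+ 1ℚ ℚ.≤ G → q ℚ.* (q ℚ.* q) ℚ.+ 1ℚ ℚ.≤ G ℚ.* (G ℚ.* G)
cube+1≤ {q} {G} 0≤q h = let open ℚ.≤-Reasoning in begin
  q ℚ.* (q ℚ.* q) ℚ.+ 1ℚ                              ≡⟨ sym (ℚ.+-identityʳ _) ⟩
  q ℚ.* (q ℚ.* q) ℚ.+ 1ℚ ℚ.+ 0ℚ
    ≤⟨ ℚ.+-monoʳ-≤ (q ℚ.* (q ℚ.* q) ℚ.+ 1ℚ) (0≤* {2ℚ ℚ.+ 1ℚ} (ℚ.≤ᵇ⇒≤ _) (ℚ.+-mono-≤ (0≤* 0≤q 0≤q) 0≤q)) ⟩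
  q ℚ.* (q ℚ.* q) ℚ.+ 1ℚ ℚ.+ (2ℚ ℚ.+ 1ℚ) ℚ.* (q ℚ.* q ℚ.+ q)  ≡⟨ lem q ⟩
  (q ℚ.+ 1ℚ) ℚ.* ((q ℚ.+ 1ℚ) ℚ.* (q ℚ.+ 1ℚ))          ≤⟨ *-mono (0≤* 0≤q+1 0≤q+1) 0≤G h (*-mono 0≤q+1 0≤G h h) ⟩
  G ℚ.* (G ℚ.* G)                                     ∎
  where
  0≤q+1 : 0ℚ ℚ.≤ q ℚ.+ 1ℚ
  0≤q+1 = ℚ.+-mono-≤ 0≤q (ℚ.≤ᵇ⇒≤ {0ℚ} {1ℚ} _)
  0≤G : 0ℚ ℚ.≤ G
  0≤G = ℚ.≤-trans 0≤q+1 h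
  lem : ∀ q → q ℚ.* (q ℚ.* q) ℚ.+ 1ℚ ℚ.+ (2ℚ ℚ.+ 1ℚ) ℚ.* (q ℚ.* q ℚ.+ q) ≡
    (q ℚ.+ 1ℚ) ℚ.* ((q ℚ.+ 1ℚ) ℚ.* (q ℚ.+ 1ℚ))
  lem = solve 1 (λ q → q :* (q :* q) :+ con 1ℚ :+ con (2ℚ ℚ.+ 1ℚ) :* (q :* q :+ q) :=
    (q :+ con 1ℚ) :* ((q :+ con 1ℚ) :* (q :+ con 1ℚ))) refl
    where open +-*-Solver

halfPow≤½ : ∀ k → halfPow (suc k) ℚ.≤ ½
halfPow≤½ k = ℚ.*-monoˡ-≤-nonNeg ½ (halfPow≤1 k)

-- The power of φ is the cube of `φ ^ k`, to which `pow≤t` applies. For each fixed `k` the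
-- approximations to φ eventually meet the tolerance `halfPow k`.
square-bound : ∀ φ → φ ^ 3 ≃ φ ^ 2 + φ + fromℕ 1 → ∀ j s → s ^ 2 ≃ φ ^ (3 ℕ.* (2 ℕ.+ j)) →
  ∃[ M ] (∀ i → M ℕ.≤ i → let G = 9 ℕ.* t (2 ℕ.+ j) in seq s i ℚ.* seq s i ℚ.≤ ι (+ (G ℕ.* (G ℕ.* G))))
square-bound φ root j s s² = M₁ ℕ.⊔ M₂ , λ i M≤i →
  -- The hypothesis `root` has a bare `φ` in the middle, so the unit in `χ` is inserted there.
  let χ< = subst (λ r → ∣ p i ℚ.* (p i ℚ.* (p i ℚ.* 1ℚ)) ℚ.- (p i ℚ.* (p i ℚ.* 1ℚ) ℚ.+ r ℚ.+ 1ℚ) ∣ ℚ.< halfPow k)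
             (sym (ℚ.*-identityʳ (p i))) (proj₂ root′ i (ℕ.m⊔n≤o⇒m≤o M₁ M₂ M≤i))
      χ<½ = ℚ.<-≤-trans χ< (halfPow≤½ (1 ℕ.+ j))
      0≤p = 0≤near-root χ<½
      p≤2 = near-root≤2 χ<½
      q = seq (φ ^ k) i
      σ = seq s i
      open ℚ.≤-Reasoning
  in begin
    σ ℚ.* σ                              ≡⟨ cong (σ ℚ.*_) (sym (ℚ.*-identityʳ σ)) ⟩
    seq (s ^ 2) i                        ≤⟨ ≤+∣-∣ (proj₂ s²′ i (ℕ.m⊔n≤o⇒n≤o M₁ M₂ M≤i)) ⟩
    seq (φ ^ (3 ℕ.* k)) i ℚ.+ 1ℚ         ≡⟨ cong (ℚ._+ 1ℚ) (pow-3 φ i k) ⟩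
    q ℚ.* (q ℚ.* q) ℚ.+ 1ℚ               ≤⟨ cube+1≤ (0≤pow φ i 0≤p p≤2 k) (pow≤t φ i 0≤p p≤2 j ℕ.≤-refl χ<) ⟩
    ι (+ G) ℚ.* (ι (+ G) ℚ.* ι (+ G))    ≡⟨ sym (trans (ι-ℕ* G (G ℕ.* G)) (cong (ι (+ G) ℚ.*_) (ι-ℕ* G G))) ⟩
    ι (+ (G ℕ.* (G ℕ.* G)))              ∎
  where
  k = 2 ℕ.+ j
  G = 9 ℕ.* t k
  p = seq φ
  root′ = root (halfPow k) (halfPow-pos k)
  s²′ = s² 1ℚ (ℚ.positive⁻¹ 1ℚ)
  M₁ = proj₁ root′
  M₂ = proj₁ s²′

theorem2 :
  ∀ (φ : ℝ) → φ ^ 3 ≃ φ ^ 2 + φ + fromℕ 1 →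
  ∀ (n k : ℕ) → 0 ℕ.< n → 4 ℕ.≤ k →
  ∃[ c ] (HasCardinality (PositiveTribonacci k n) c ×
    -- s is φ^{3k/2} and N is ⌈ 1500 n / s ⌉
    (∀ (s : ℝ) (s>0 : fromℕ 0 < s) → s ^ 2 ≃ φ ^ (3 ℕ.* k) →
     ∀ (N : ℤ) → IsCeiling (fromℕ 1500 * (fromℕ n ÷ s [ s>0 ])) N →
     + c ℤ.≤ N ℤ.^ 2))
theorem2 φ root n (suc (suc (suc (suc j)))) n>0 (ℕ.s≤s (ℕ.s≤s (ℕ.s≤s (ℕ.s≤s ℕ.z≤n)))) =
  length (solutions j n) , solutions-cardinality j n , bound
  where
  T = t (4 ℕ.+ j)
  G = 9 ℕ.* T
  G≥1 : 1 ℕ.≤ G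
  G≥1 = ℕ.*-mono-≤ {1} {9} (ℕ.s≤s ℕ.z≤n) (t≥1 (2 ℕ.+ j))
  cube-scale : ∀ c T → (c ℕ.* T) ℕ.* ((c ℕ.* T) ℕ.* (c ℕ.* T)) ≡ c ℕ.* c ℕ.* c ℕ.* (T ℕ.* T ℕ.* T)
  cube-scale = ℕRing.solve-∀
  bound : ∀ s (s>0 : fromℕ 0 < s) → s ^ 2 ≃ φ ^ (3 ℕ.* (4 ℕ.+ j)) →
    ∀ N → IsCeiling (fromℕ 1500 * (fromℕ n ÷ s [ s>0 ])) N → + length (solutions j n) ℤ.≤ N ℤ.^ 2
  bound s s>0 s² N (x≤N , _) =
    let m , N≡ , m≥1 , h = ceiling-bound {1499} {n} {G ℕ.* (G ℕ.* G)} N s s>0 (ℕ.s≤s ℕ.z≤n) n>0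
          (ℕ.*-mono-≤ G≥1 (ℕ.*-mono-≤ G≥1 G≥1)) (square-bound φ root (2 ℕ.+ j) s s²) x≤N
        -- `1499` is `1500` minus the loss in `ceiling-numerator`, and `729 = 9³` is the cubed
        -- constant of `pow≤t`. The requirement amounts to `48 · 27 = 1296 < 1499`.
        count≤ = solutions-bound {1499} {729} j n m {{ℕ.>-nonZero n>0}}
          (ℕ.≤ᵇ⇒≤ (suc (2304 ℕ.* 729)) (1499 ℕ.* 1499) _) m≥1
          (subst (λ E → (1499 ℕ.* n) ℕ.* (1499 ℕ.* n) ℕ.≤ m ℕ.* m ℕ.* E) (cube-scale 9 T) h)
    in subst (λ N → + length (solutions j n) ℤ.≤ N ℤ.^ 2) (sym N≡)
      (subst (+ length (solutions j n) ℤ.≤_) (m²≡ m) (ℤ.+≤+ count≤))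
    where
    m²≡ : ∀ m → + (m ℕ.* m) ≡ (+ m) ℤ.^ 2
    m²≡ m = trans (ℤ.pos-* m m) (cong (+ m ℤ.*_) (sym (ℤ.*-identityʳ (+ m))))
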